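{- Let $S,T$ be dual equivalent standard skew tableaux whose row sizes are weakly decreasing from top to bottom. Then $\mathrm{stab}(S)=\mathrm{stab}(T)$.
   Context: A standard skew tableau of size $m$ is a filling of a skew shape (English notation) with $1,\dots,m$ each once, increasing along rows and down columns; its reading word reads rows left to right from the bottom row to the top row. For an integer $i$, the elementary dual equivalence move $d_i$ acts on a standard skew tableau as follows: if $i-1$ lies between $i$ and $i+1$ in reading order, swap the entries $i$ and $i+1$; if $i+1$ lies between $i-1$ and $i$ in reading order, swap the entries $i-1$ and $i$; otherwise do nothing. Two standard skew tableaux are dual equivalent if one is obtained from the other by a sequence of such moves. $S+x$ adds $x$ to every entry. $\mathrm{Rect}$ is jeu de taquin rectification. For $S$ of size $m$ with weakly decreasing row sizes and $k\ge1$, $S^{(k)}$ is the standard skew tableau whose $i$-th row consists of the $i$-th row of $S$ followed immediately to the right by the $i$-th rows of $S+m,\dots,S+(k-1)m$. $S$ stabilizes at $k$ if every entry of $[(k-1)m+1,km]$ lies in the same row of $\mathrm{Rect}(S^{(k)})$ as in $S^{(k)}$; $\mathrm{stab}(S)$ is the least $k\ge1$ at which $S$ stabilizes. -}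

module Defs where

open import Data.Nat using (ℕ; zero; suc; _+_; _*_; _∸_; _≤_; _<_; _<ᵇ_; _≡ᵇ_)
open import Data.Bool using (Bool; true; false; if_then_else_; _∧_; _∨_)
open import Data.List using (List; []; _∷_; _++_; map; length; concat; concatMap; reverse; replicate; take; upTo)
open import Data.Nat.ListAction using (sum)
open import Data.List.Relation.Binary.Permutation.Propositional using (_↭_)
open import Data.Maybe using (Maybe; just; nothing)
open import Data.Product using (_×_; _,_; proj₁; proj₂; ∃)
open import Relation.Binary.PropositionalEquality using (_≡_)
open import Relation.Binary.Construct.Closure.ReflexiveTransitive using (Star)
open import Relation.Nullary using (¬_)

-- Representation of skew tableaux (English notation).
-- A skew tableau of shape λ/μ is a list of rows, top row first; row i is
-- the pair (μ_i , w_i): μ_i empty (inner) cells, followed by the entries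
-- w_i occupying columns μ_i, …, μ_i + length w_i - 1 (columns from 0).
-- Row i of the tableau is row i of the plane (rows numbered from 0).

SkewTab : Set
SkewTab = List (ℕ × List ℕ)

nth : {A : Set} → List A → ℕ → Maybe A
nth []       _       = nothing
nth (x ∷ xs) zero    = just x
nth (x ∷ xs) (suc n) = nth xs n

entryAt : SkewTab → ℕ → ℕ → Maybe ℕ
entryAt S r c with nth S r
... | nothing      = nothing
... | just (a , w) = if c <ᵇ a then nothing else nth w (c ∸ a)

size : SkewTab → ℕ
size S = sum (map (λ p → length (proj₂ p)) S)

readingWord : SkewTab → List ℕ
readingWord S = concat (reverse (map proj₂ S))

record IsStandardSkew (S : SkewTab) : Set where
  field
    skewShape : ∀ r a u b v → nth S r ≡ just (a , u) → nth S (suc r) ≡ just (b , v) →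
                (b ≤ a) × (b + length v ≤ a + length u)
    rowsIncr  : ∀ r c x y → entryAt S r c ≡ just x → entryAt S r (suc c) ≡ just y → x < y
    colsIncr  : ∀ r c x y → entryAt S r c ≡ just x → entryAt S (suc r) c ≡ just y → x < y
    entries   : readingWord S ↭ map suc (upTo (size S))

RowSizesDecreasing : SkewTab → Set
RowSizesDecreasing S = ∀ r a u b v → nth S r ≡ just (a , u) → nth S (suc r) ≡ just (b , v) →
                       length v ≤ length u

pos : List ℕ → ℕ → Maybe ℕ
pos []       x = nothing
pos (y ∷ ys) x = if y ≡ᵇ x then just zero else Data.Maybe.map suc (pos ys x)
  where import Data.Maybe

between : ℕ → ℕ → ℕ → Bool
between p q r = ((q <ᵇ p) ∧ (p <ᵇ r)) ∨ ((r <ᵇ p) ∧ (p <ᵇ q))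

swapEntries : ℕ → ℕ → SkewTab → SkewTab
swapEntries x y = map (λ p → proj₁ p , map sw (proj₂ p))
  where
  sw : ℕ → ℕ
  sw z = if z ≡ᵇ x then y else (if z ≡ᵇ y then x else z)

dmove : ℕ → SkewTab → SkewTab
dmove zero S = S
dmove (suc j) S = go (pos w j) (pos w (suc j)) (pos w (suc (suc j)))
  where
  w = readingWord S
  go : Maybe ℕ → Maybe ℕ → Maybe ℕ → SkewTab
  go (just a) (just b) (just c) =
    if between a b c then swapEntries (suc j) (suc (suc j)) S
    else (if between c a b then swapEntries j (suc j) S else S)
  go _ _ _ = S

DMove : SkewTab → SkewTab → Set
DMove S T = ∃ λ i → T ≡ dmove i S

DualEquivalent : SkewTab → SkewTab → Set
DualEquivalent = Star DMove

shiftRow : ℕ → List ℕ → List ℕ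
shiftRow x = map (λ z → z + x)

power : SkewTab → ℕ → SkewTab
power S k = map (λ p → proj₁ p , concatMap (λ j → shiftRow (j * size S) (proj₂ p)) (upTo k)) S

-- Jeu de taquin on grids (rows of cells; nothing = empty cell)

Grid : Set
Grid = List (List (Maybe ℕ))

toGrid : SkewTab → Grid
toGrid = map (λ p → replicate (proj₁ p) nothing ++ map just (proj₂ p))

upd : {A : Set} → (A → A) → ℕ → List A → List A
upd f n       []       = []
upd f zero    (x ∷ xs) = f x ∷ xs
upd f (suc n) (x ∷ xs) = x ∷ upd f n xs

get : Grid → ℕ → ℕ → Maybe ℕ
get g r c with nth g r
... | nothing  = nothing
... | just row with nth row c
...   | nothing = nothing
...   | just v  = v

set : Grid → ℕ → ℕ → Maybe ℕ → Grid
set g r c v = upd (upd (λ _ → v) c) r g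

-- forward slide of the hole at (r , c); the fuel bounds the number of steps
slide : ℕ → ℕ → ℕ → Grid → Grid
slide zero    r c g = g
slide (suc f) r c g = step (get g r (suc c)) (get g (suc r) c)
  where
  right : ℕ → Grid
  right x = slide f r (suc c) (set (set g r c (just x)) r (suc c) nothing)
  down : ℕ → Grid
  down y = slide f (suc r) c (set (set g r c (just y)) (suc r) c nothing)
  step : Maybe ℕ → Maybe ℕ → Grid
  step nothing  nothing  = upd (take c) r g   -- hole leaves the shape
  step (just x) nothing  = right x
  step nothing  (just y) = down y
  step (just x) (just y) = if x <ᵇ y then right x else down y

leading : List (Maybe ℕ) → ℕ
leading []             = zero
leading (nothing ∷ xs) = suc (leading xs)
leading (just _ ∷ xs)  = zero

-- inner corner: last inner cell of the lowest row having inner cells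
findCorner : Grid → Maybe (ℕ × ℕ)
findCorner []       = nothing
findCorner (row ∷ g) with findCorner g
... | just (r , c) = just (suc r , c)
... | nothing with leading row
...   | zero  = nothing
...   | suc c = just (zero , c)

cells : Grid → ℕ
cells g = length g + sum (map length g)

rectify : ℕ → Grid → Grid
rectify zero    g = g
rectify (suc f) g with findCorner g
... | nothing      = g
... | just (r , c) = rectify f (slide (suc (cells g)) r c g)

Rect : SkewTab → Grid
Rect S = rectify (sum (map proj₁ S)) (toGrid S)

rowOf : Grid → ℕ → Maybe ℕ
rowOf []        x = nothing
rowOf (row ∷ g) x = if inRow row then just zero else Data.Maybe.map suc (rowOf g x)
  where
  import Data.Maybe
  inRow : List (Maybe ℕ) → Bool
  inRow []             = false
  inRow (nothing ∷ ys) = inRow ys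
  inRow (just y ∷ ys)  = (y ≡ᵇ x) ∨ inRow ys

StabilizesAt : SkewTab → ℕ → Set
StabilizesAt S k = ∀ x → (k ∸ 1) * size S < x → x ≤ k * size S →
                   rowOf (Rect (power S k)) x ≡ rowOf (toGrid (power S k)) x

IsStab : SkewTab → ℕ → Set
IsStab S k = (1 ≤ k) × StabilizesAt S k × (∀ j → 1 ≤ j → j < k → ¬ StabilizesAt S j)

-- The move d_i on S lifts to S^(k) as the sequence of moves d_i, d_{i+m}, …,
-- d_{i+(k-1)m}, one in each copy of S, and elementary dual equivalence moves commute
-- with jeu de taquin, so the same sequence of moves takes Rect(S^(k)) to Rect(T^(k)).
-- Only the last of them affects the entries of the last copy. Which interchange it
-- performs depends only on the rows of i − 1, i, i + 1, so if these agree in S^(k) and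
-- Rect(S^(k)), the rows of the last copy still agree after the move.
--
-- For the commutation, every step of a slide preserves the descents (j is a descent if
-- j + 1 lies in a lower row), and d_i is the interchange for which exactly one of
-- i − 1, i is a descent before and exactly the other one after. Hence it suffices that
-- the two slides follow the same path, which fails in a single local configuration.

module Submission where

open import Defs
open import Data.Nat using (ℕ; zero; suc; _+_; _*_; _∸_; _≤_; _<_; _≮_; _<ᵇ_; _≡ᵇ_; z≤n; s≤s; _≟_; _<?_)
open import Data.Nat.Properties
open import Data.Nat.ListAction using (sum)
open import Data.Bool using (Bool; true; false; if_then_else_; _∨_)
import Data.Bool as Bool
open import Data.Unit using (tt)
open import Data.Maybe using (Maybe; just; nothing)
import Data.Maybe as Maybe
open import Data.Maybe.Properties using (just-injective)
open import Data.List using (List; []; _∷_; _++_; map; length; concat; concatMap; reverse; replicate; take; upTo)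
open import Data.List.Properties using (length-map; length-++; map-∘; map-++; map-id; map-cong-local; concatMap-++; upTo-∷ʳ; ++-identityʳ; unfold-reverse; concat-++)
open import Data.Product using (_×_; _,_; proj₁; proj₂; ∃; ∃₂; map₂; swap)
open import Data.Sum using (_⊎_; inj₁; inj₂)
open import Data.Empty using (⊥; ⊥-elim)
open import Relation.Binary.PropositionalEquality using (setoid; _≡_; _≢_; refl; sym; trans; cong; cong₂; subst; subst₂)
open import Data.List.Membership.Propositional using (_∈_)
open import Data.List.Membership.Propositional.Properties using (∈-++⁺ˡ; ∈-++⁺ʳ; ∈-map⁻; ∈-upTo⁻)
open import Data.List.Relation.Unary.Any using (here; there)
open import Data.List.Relation.Unary.All as All using (All; []; _∷_; lookup)
open import Data.List.Relation.Unary.All.Properties using (++⁻ˡ; ++⁻ʳ)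
open import Data.List.Relation.Unary.AllPairs using ([]; _∷_)
open import Data.List.Relation.Unary.Unique.Propositional using (Unique)
open import Data.List.Relation.Unary.Unique.Propositional.Properties using (map⁺; upTo⁺)
open import Data.List.Relation.Binary.Permutation.Propositional using (↭-sym; ↭⇒↭ₛ)
open import Data.List.Relation.Binary.Permutation.Propositional.Properties using (∈-resp-↭)
open import Data.List.Relation.Binary.Permutation.Setoid.Properties (setoid ℕ) using (Unique-resp-↭)
open import Relation.Binary.Construct.Closure.ReflexiveTransitive using (Star; ε; _◅_)
open import Function using (_∘_; id; flip; case_of_)
open import Relation.Binary using (tri<; tri≈; tri>)
open import Relation.Nullary using (¬_; Dec; yes; no; contradiction)
open import Relation.Nullary.Decidable using (dec-true; dec-false; _×-dec_)

-- Cells and valid fillings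

-- A slide need not respect which pair is interchanged: an interchange of `p`, `p + 1` before it can
-- become one of `p + 1`, `p + 2` after it. `Dual` therefore leaves the pair open and relies on the
-- exchange of descents, which has the same form for both pairs. The interchange of `p + 1`, `p + 2`
-- never separates the two slides. That of `p`, `p + 1` does so where these two are the neighbours
-- of the hole; the exchange then forces `p + 2` into the diagonal cell, and this is what brings the
-- slides together again. The positional arguments share one pattern: a cell that must be filled
-- lies between two of the entries `p`, `p + 1`, `p + 2`, so its value is forced or impossible.
-- After some but not all of the lifted moves the tableau is in general not a power. Hence the
-- statements concern arbitrary valid grids, and a move keeps validity because of the exchange.
-- Since the relation is symmetric, agreement of rows passes through these intermediate grids in
-- both directions, which gives the equivalence.

Cells : Set
Cells = ℕ → ℕ → Maybe (Maybe ℕ)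

pattern blank   = just nothing
pattern entry x = just (just x)

opaque
  -- The outer `nothing` is a position outside the grid, `blank` an inner cell or the hole. `get`
  -- merges the two, but only the latter belong to the shape.
  cell : Grid → Cells
  cell g r c = nth g r Maybe.>>= λ row → nth row c

At : ℕ → ℕ → ℕ → ℕ → Set
At r c r' c' = r' ≡ r × c' ≡ c

Nowhere : ℕ → ℕ → Set
Nowhere _ _ = ⊥

-- A skew tableau in which the cells marked by H are blank although they belong
-- to the shape; every other blank cell is an inner cell.
record Valid (F : Cells) (H : ℕ → ℕ → Set) : Set where
  field
    range    : ∀ {r c r' c' v} → F r c ≡ just v → r' ≤ r → c' ≤ c → ∃ λ v' → F r' c' ≡ just v'
    inner    : ∀ {r c r' c'} → F r c ≡ blank → ¬ H r c → r' ≤ r → c' ≤ c → F r' c' ≡ blank × ¬ H r' c'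
    hole     : ∀ {r c} → H r c → F r c ≡ blank
    rowIncr  : ∀ {r c c' x y} → F r c ≡ entry x → F r c' ≡ entry y → c < c' → x < y
    colIncr  : ∀ {r r' c x y} → F r c ≡ entry x → F r' c ≡ entry y → r < r' → x < y
    distinct : ∀ {r c r' c' x} → F r c ≡ entry x → F r' c' ≡ entry x → r ≡ r' × c ≡ c'

  -- A blank cell other than the hole is inner, and then so is everything weakly above and left of
  -- it; neither the hole nor an entry can lie there. This supplies the intermediate entries in all
  -- later comparisons.
  filled : ∀ {r c v r₀ c₀} → F r c ≡ just v → ¬ H r c → r₀ ≤ r → c₀ ≤ c →
           H r₀ c₀ ⊎ (∃ λ x → F r₀ c₀ ≡ entry x) → ∃ λ x → F r c ≡ entry x
  filled {v = just x}  eq _  _ _ _ = x , eq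
  filled {v = nothing} eq ¬h p q o with inner eq ¬h p q
  filled {v = nothing} eq ¬h p q (inj₁ h)       | _ , ¬h₀ = contradiction h ¬h₀
  filled {v = nothing} eq ¬h p q (inj₂ (_ , e)) | b , _ with () ← trans (sym b) e

open Valid

entry-injective : ∀ {x y : ℕ} → _≡_ {A = Maybe (Maybe ℕ)} (entry x) (entry y) → x ≡ y
entry-injective refl = refl

entry≢blank : ∀ {m : Maybe (Maybe ℕ)} {x} {A : Set} → m ≡ entry x → m ≡ blank → A
entry≢blank refl ()

-- The cell in the row of the first entry and the column of the second is filled, so one can compare
-- along a row and then down a column.
mono : ∀ {F r c r' c' x y} → Valid F Nowhere → F r c ≡ entry x → F r' c' ≡ entry y →
       r ≤ r' → c ≤ c' → x ≤ y
mono V p q r≤ c≤ with range V q r≤ ≤-refl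
... | _ , e with filled V e id ≤-refl c≤ (inj₂ (_ , p))
... | z , e' = ≤-trans (along (m≤n⇒m<n∨m≡n c≤)) (down (m≤n⇒m<n∨m≡n r≤))
  where
  along : _ → _ ≤ z
  along (inj₁ lt)   = <⇒≤ (rowIncr V p e' lt)
  along (inj₂ refl) = ≤-reflexive (entry-injective (trans (sym p) e'))
  down : _ → z ≤ _
  down (inj₁ lt)   = <⇒≤ (colIncr V e' q lt)
  down (inj₂ refl) = ≤-reflexive (entry-injective (trans (sym e') q))

at? : ∀ r c r' c' → Dec (At r c r' c')
at? r c r' c' = (r' ≟ r) ×-dec (c' ≟ c)

-- The entry v moves from (r₂ , c₂) into the hole at (r , c).
record Move (F G : Cells) (r c r₂ c₂ v : ℕ) : Set where
  field
    source : F r₂ c₂ ≡ entry v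
    target : F r c ≡ blank
    filled-target : G r c ≡ entry v
    empty-source  : G r₂ c₂ ≡ blank
    same   : ∀ {r' c'} → ¬ At r c r' c' → ¬ At r₂ c₂ r' c' → G r' c' ≡ F r' c'

  origin : ∀ {a b z} → G a b ≡ entry z →
           (At r c a b × z ≡ v) ⊎ (F a b ≡ entry z × ¬ At r c a b × ¬ At r₂ c₂ a b)
  origin {a} {b} p with at? r c a b | at? r₂ c₂ a b
  ... | yes (refl , refl) | _                 = inj₁ ((refl , refl) , entry-injective (trans (sym p) filled-target))
  ... | no _              | yes (refl , refl) = entry≢blank p empty-source
  ... | no ¬A             | no ¬B             = inj₂ (trans (sym (same ¬A ¬B)) p , ¬A , ¬B)

  defined : ∀ {a b w} → G a b ≡ just w → ∃ λ w' → F a b ≡ just w'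
  defined {a} {b} p with at? r c a b | at? r₂ c₂ a b
  ... | yes (refl , refl) | _                 = _ , target
  ... | no _              | yes (refl , refl) = _ , source
  ... | no ¬A             | no ¬B             = _ , trans (sym (same ¬A ¬B)) p

  defined⁻ : ∀ {a b w} → F a b ≡ just w → ∃ λ w' → G a b ≡ just w'
  defined⁻ {a} {b} p with at? r c a b | at? r₂ c₂ a b
  ... | yes (refl , refl) | _                 = _ , filled-target
  ... | no _              | yes (refl , refl) = _ , empty-source
  ... | no ¬A             | no ¬B             = _ , trans (same ¬A ¬B) p

open Move

-- Only the comparisons of `v` within column `c` are new. Entries below the hole are covered by the
-- hypothesis; for an entry above it, its right neighbour lies between it and `v`.
move-right-valid : ∀ {F G r c v} → Valid F (At r c) → Move F G r c r (suc c) v →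
                   (∀ {r₀ z} → r < r₀ → F r₀ c ≡ entry z → v < z) → Valid G (At r (suc c))
move-right-valid {F} {G} {r} {c} {v} V M below = record
  { range    = λ p r≤ c≤ → let _ , q = defined M p ; _ , q' = range V q r≤ c≤ in defined⁻ M q'
  ; inner    = inner'
  ; hole     = λ { (refl , refl) → empty-source M }
  ; rowIncr  = λ p q lt → rows (origin M p) (origin M q) lt
  ; colIncr  = λ p q lt → cols (origin M p) (origin M q) lt
  ; distinct = λ p q → dist (origin M p) (origin M q)
  }
  where
  inner' : ∀ {a b a' b'} → G a b ≡ blank → ¬ At r (suc c) a b → a' ≤ a → b' ≤ b →
           G a' b' ≡ blank × ¬ At r (suc c) a' b'
  inner' {a} {b} p ¬B a≤ b≤ with at? r c a b
  ... | yes (refl , refl) = entry≢blank (filled-target M) p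
  ... | no ¬A with inner V (trans (sym (same M ¬A ¬B)) p) ¬A a≤ b≤
  ...   | q , ¬A' = trans (same M ¬A' ¬B') q , ¬B'
    where
    ¬B' : ¬ At r (suc c) _ _
    ¬B' (refl , refl) = entry≢blank (source M) q
  rows : ∀ {a b b' x y} → (At r c a b × x ≡ v) ⊎ (F a b ≡ entry x × ¬ At r c a b × ¬ At r (suc c) a b) →
         (At r c a b' × y ≡ v) ⊎ (F a b' ≡ entry y × ¬ At r c a b' × ¬ At r (suc c) a b') → b < b' → x < y
  rows (inj₁ ((refl , refl) , refl)) (inj₁ ((_ , refl) , _)) lt = contradiction lt (<-irrefl refl)
  rows (inj₁ ((refl , refl) , refl)) (inj₂ (q , _ , ¬B)) lt =
    rowIncr V (source M) q (≤∧≢⇒< lt λ e → ¬B (refl , sym e))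
  rows (inj₂ (p , _ , _)) (inj₁ ((refl , refl) , refl)) lt = rowIncr V p (source M) (<-trans lt (n<1+n _))
  rows (inj₂ (p , _ , _)) (inj₂ (q , _ , _)) lt = rowIncr V p q lt
  cols : ∀ {a a' b x y} → (At r c a b × x ≡ v) ⊎ (F a b ≡ entry x × ¬ At r c a b × ¬ At r (suc c) a b) →
         (At r c a' b × y ≡ v) ⊎ (F a' b ≡ entry y × ¬ At r c a' b × ¬ At r (suc c) a' b) → a < a' → x < y
  cols (inj₁ ((refl , refl) , refl)) (inj₁ ((refl , _) , _)) lt = contradiction lt (<-irrefl refl)
  cols (inj₁ ((refl , refl) , refl)) (inj₂ (q , _ , _)) lt = below lt q
  cols (inj₂ (p , _ , _)) (inj₁ ((refl , refl) , refl)) lt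
    with range V (source M) (<⇒≤ lt) ≤-refl
  ... | _ , e with filled V e (λ { (refl , _) → <-irrefl refl lt }) ≤-refl (n≤1+n _) (inj₂ (_ , p))
  ... | _ , e' = <-trans (rowIncr V p e' (n<1+n _)) (colIncr V e' (source M) lt)
  cols (inj₂ (p , _ , _)) (inj₂ (q , _ , _)) lt = colIncr V p q lt
  dist : ∀ {a b a' b' x} → (At r c a b × x ≡ v) ⊎ (F a b ≡ entry x × ¬ At r c a b × ¬ At r (suc c) a b) →
         (At r c a' b' × x ≡ v) ⊎ (F a' b' ≡ entry x × ¬ At r c a' b' × ¬ At r (suc c) a' b') → a ≡ a' × b ≡ b'
  dist (inj₁ ((refl , refl) , refl)) (inj₁ ((refl , refl) , _)) = refl , refl
  dist (inj₁ (_ , refl)) (inj₂ (q , _ , ¬B)) = contradiction (distinct V q (source M)) ¬B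
  dist (inj₂ (p , _ , ¬B)) (inj₁ (_ , refl)) = contradiction (distinct V p (source M)) ¬B
  dist (inj₂ (p , _ , _)) (inj₂ (q , _ , _)) = distinct V p q

-- Reflection in the main diagonal turns a downward move into a move to the left, so one validity
-- proof serves both directions.
transpose-valid : ∀ {F r c} → Valid F (At r c) → Valid (flip F) (At c r)
transpose-valid V = record
  { range    = λ p r≤ c≤ → range V p c≤ r≤
  ; inner    = λ p ¬h r≤ c≤ → let q , ¬h' = inner V p (λ (a , b) → ¬h (b , a)) c≤ r≤ in q , λ (a , b) → ¬h' (b , a)
  ; hole     = λ (a , b) → hole V (b , a)
  ; rowIncr  = colIncr V
  ; colIncr  = rowIncr V
  ; distinct = λ p q → let a , b = distinct V p q in b , a
  }

transpose-move : ∀ {F G r c r₂ c₂ v} → Move F G r c r₂ c₂ v → Move (flip F) (flip G) c r c₂ r₂ v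
transpose-move M = record
  { source = source M
  ; target = target M
  ; filled-target = filled-target M
  ; empty-source  = empty-source M
  ; same = λ ¬A ¬B → same M (λ (a , b) → ¬A (b , a)) (λ (a , b) → ¬B (b , a))
  }

move-down-valid : ∀ {F G r c v} → Valid F (At r c) → Move F G r c (suc r) c v →
                  (∀ {c₀ z} → c < c₀ → F r c₀ ≡ entry z → v < z) → Valid G (At (suc r) c)
move-down-valid V M beside = transpose-valid (move-right-valid (transpose-valid V) (transpose-move M) beside)

-- Rows of entries and descents

InRow : Cells → ℕ → ℕ → Set
InRow F r x = ∃ λ c → F r c ≡ entry x

row-unique : ∀ {F H r r' x} → Valid F H → InRow F r x → InRow F r' x → r ≡ r'
row-unique V (_ , p) (_ , q) = proj₁ (distinct V p q)

Descent : Cells → ℕ → Set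
Descent F x = ∃₂ λ r r' → InRow F r x × InRow F r' (suc x) × r < r'

-- A positive statement that includes the presence of both entries, not the negation of `Descent`;
-- each of the two is carried through slides separately.
Ascent : Cells → ℕ → Set
Ascent F x = ∃₂ λ r r' → InRow F r x × InRow F r' (suc x) × r' ≤ r

ascent-descent : ∀ {F H x} {A : Set} → Valid F H → Ascent F x → Descent F x → A
ascent-descent V (_ , _ , p , q , le) (_ , _ , p' , q' , lt)
  with refl ← row-unique V p p' | refl ← row-unique V q q' = contradiction lt (≤⇒≯ le)

private
  keeps-row : ∀ {F G r c r₂ c₂ v a x} → Valid F (At r c) → Move F G r c r₂ c₂ v → InRow F a x → x ≢ v → InRow G a x
  keeps-row {r = r} {c} {r₂} {c₂} {a = a} V M (b , p) x≢v with at? r c a b | at? r₂ c₂ a b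
  ... | yes (refl , refl) | _ = entry≢blank p (target M)
  ... | no _ | yes (refl , refl) = contradiction (entry-injective (trans (sym p) (source M))) x≢v
  ... | no ¬A | no ¬B = b , trans (same M ¬A ¬B) p

move-right-row : ∀ {F G r c v a x} → Valid F (At r c) → Move F G r c r (suc c) v → InRow F a x → InRow G a x
move-right-row {v = v} {x = x} V M p with x ≟ v
... | no x≢v = keeps-row V M p x≢v
... | yes refl with refl ← row-unique V p (_ , source M) = _ , filled-target M

module _ {F G r c v} (V : Valid F (At r c)) (M : Move F G r c (suc r) c v)
         (beside : ∀ {c₀ z} → c < c₀ → F r c₀ ≡ entry z → v < z) where

  private
    moved : InRow G r v
    moved = _ , filled-target M

    -- Were x = v − 1 in row r, it would lie left of the hole; but then the entry
    -- below it would lie strictly between x and v.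
    not-pred-beside : ∀ {x b} → F r b ≡ entry x → ¬ v ≡ suc x
    not-pred-beside {x} {b} p refl with <-cmp b c
    ... | tri≈ _ refl _ = entry≢blank p (target M)
    ... | tri> _ _ lt   = <⇒≱ (beside lt p) (n≤1+n _)
    ... | tri< lt _ _ with range V (source M) ≤-refl (<⇒≤ lt)
    ...   | _ , e with filled V e (λ { (() , _) }) (n≤1+n r) ≤-refl (inj₂ (_ , p))
    ...     | _ , e' = <⇒≱ (colIncr V p e' (n<1+n _)) (≤-pred (rowIncr V e' (source M) lt))

    -- Were `v + 1` in row `r + 1`, it would lie right of `v`; the entry above it would then exceed
    -- `v` and still be less than `v + 1`.
    not-succ-below : ∀ {x b} → F (suc r) b ≡ entry x → ¬ x ≡ suc v
    not-succ-below {x} {b} p refl with <-cmp b c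
    ... | tri≈ _ refl _ = 1+n≢n (entry-injective (trans (sym p) (source M)))
    ... | tri< lt _ _   = <⇒≱ (rowIncr V p (source M) lt) (n≤1+n _)
    ... | tri> _ _ lt with range V p (n≤1+n r) ≤-refl
    ...   | _ , e with filled V e (λ { (_ , refl) → <-irrefl refl lt }) ≤-refl (<⇒≤ lt) (inj₁ (refl , refl))
    ...     | _ , e' = <⇒≱ (beside lt e') (≤-pred (colIncr V e' p (n<1+n _)))

  -- Only `v` changes its row, and it rises by one. A descent at `v` is kept, and one at `v - 1`
  -- could be lost only with `v - 1` in row `r`.
  move-down-descent : ∀ {x} → Descent F x → Descent G x
  move-down-descent {x} (a , a' , p , q , lt) with x ≟ v | suc x ≟ v
  ... | yes refl | _
    with refl ← row-unique V p (_ , source M) = _ , _ , moved , keeps-row V M q 1+n≢n , <-trans (n<1+n _) lt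
  ... | no x≢v | yes refl
    with refl ← row-unique V q (_ , source M) =
      _ , _ , keeps-row V M p x≢v , moved , ≤∧≢⇒< (≤-pred lt) λ { refl → not-pred-beside (proj₂ p) refl }
  ... | no x≢v | no sx≢v = _ , _ , keeps-row V M p x≢v , keeps-row V M q sx≢v , lt

  -- As `v` rises by one row, an ascent could be lost only at `v`, with `v + 1` in the row that `v`
  -- leaves.
  move-down-ascent : ∀ {x} → Ascent F x → Ascent G x
  move-down-ascent {x} (a , a' , p , q , le) with x ≟ v | suc x ≟ v
  ... | yes refl | _
    with refl ← row-unique V p (_ , source M) =
      _ , _ , moved , keeps-row V M q 1+n≢n , ≤-pred (≤∧≢⇒< le λ { refl → not-succ-below (proj₂ q) refl })
  ... | no x≢v | yes refl
    with refl ← row-unique V q (_ , source M) =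
      _ , _ , keeps-row V M p x≢v , moved , ≤-trans (n≤1+n _) le
  ... | no x≢v | no sx≢v = _ , _ , keeps-row V M p x≢v , keeps-row V M q sx≢v , le

-- Grids

opaque
  unfolding cell

  get-entry : ∀ {g r c x} → get g r c ≡ just x → cell g r c ≡ entry x
  get-entry {g} {r} {c} eq with nth g r
  ... | just row with nth row c
  get-entry refl | just row | just _ = refl

  cell-get : ∀ {g r c v} → cell g r c ≡ just v → get g r c ≡ v
  cell-get {g} {r} {c} eq with nth g r
  ... | just row with nth row c
  cell-get refl | just row | just _ = refl

  get-nothing : ∀ {g r c} → get g r c ≡ nothing → cell g r c ≡ nothing ⊎ cell g r c ≡ blank
  get-nothing {g} {r} {c} eq with nth g r
  ... | nothing = inj₁ refl
  ... | just row with nth row c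
  ...   | nothing = inj₁ refl
  get-nothing refl | just row | just nothing = inj₂ refl

nth-upd-≡ : ∀ {A : Set} (f : A → A) n xs → nth (upd f n xs) n ≡ Maybe.map f (nth xs n)
nth-upd-≡ f zero    []       = refl
nth-upd-≡ f (suc n) []       = refl
nth-upd-≡ f zero    (x ∷ xs) = refl
nth-upd-≡ f (suc n) (x ∷ xs) = nth-upd-≡ f n xs

nth-upd-≢ : ∀ {A : Set} (f : A → A) {n m} xs → m ≢ n → nth (upd f n xs) m ≡ nth xs m
nth-upd-≢ f []       ne = refl
nth-upd-≢ f {zero}  {zero}  (x ∷ xs) ne = contradiction refl ne
nth-upd-≢ f {zero}  {suc m} (x ∷ xs) ne = refl
nth-upd-≢ f {suc n} {zero}  (x ∷ xs) ne = refl
nth-upd-≢ f {suc n} {suc m} (x ∷ xs) ne = nth-upd-≢ f xs (ne ∘ cong suc)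

opaque
  unfolding cell

  cell-set-≡ : ∀ {g r c w} v → cell g r c ≡ just w → cell (set g r c v) r c ≡ just v
  cell-set-≡ {g} {r} {c} v eq rewrite nth-upd-≡ (upd (λ _ → v) c) r g with nth g r
  ... | just row rewrite nth-upd-≡ (λ _ → v) c row | eq = refl

  cell-set-≢ : ∀ {g r c r' c'} v → ¬ At r c r' c' → cell (set g r c v) r' c' ≡ cell g r' c'
  cell-set-≢ {g} {r} {c} {r'} {c'} v ne with r' ≟ r
  ... | no r≢ rewrite nth-upd-≢ (upd (λ _ → v) c) g r≢ = refl
  ... | yes refl rewrite nth-upd-≡ (upd (λ _ → v) c) r g with nth g r
  ...   | nothing  = refl
  ...   | just row = nth-upd-≢ (λ _ → v) row (λ c≡ → ne (refl , c≡))

map-length-upd : ∀ {A : Set} (f : List A → List A) n g → (∀ xs → length (f xs) ≡ length xs) →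
                 map length (upd f n g) ≡ map length g
map-length-upd f n       []      eq = refl
map-length-upd f zero    (x ∷ g) eq = cong (_∷ _) (eq x)
map-length-upd f (suc n) (x ∷ g) eq = cong (_ ∷_) (map-length-upd f n g eq)

length-upd : ∀ {A : Set} (f : A → A) n xs → length (upd f n xs) ≡ length xs
length-upd f n       []       = refl
length-upd f zero    (x ∷ xs) = refl
length-upd f (suc n) (x ∷ xs) = cong suc (length-upd f n xs)

cells-set : ∀ g r c v → cells (set g r c v) ≡ cells g
cells-set g r c v = cong₂ _+_ (length-upd _ r g) (cong sum (map-length-upd _ r g (length-upd _ c)))

nth-< : ∀ {A : Set} (xs : List A) {n x} → nth xs n ≡ just x → n < length xs
nth-< (_ ∷ _)  {zero}  eq = s≤s z≤n
nth-< (_ ∷ xs) {suc n} eq = s≤s (nth-< xs eq)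

nth-defined : ∀ {A : Set} (xs : List A) {n} → n < length xs → ∃ λ x → nth xs n ≡ just x
nth-defined (x ∷ xs) {zero}  lt       = x , refl
nth-defined (x ∷ xs) {suc n} (s≤s lt) = nth-defined xs lt

opaque
  unfolding cell

  cell-row : ∀ {g r c v} → cell g r c ≡ just v → ∃ λ row → nth g r ≡ just row × nth row c ≡ just v
  cell-row {g} {r} eq with nth g r
  ... | just row = row , refl , eq

  row-cell : ∀ {g r c v row} → nth g r ≡ just row → nth row c ≡ just v → cell g r c ≡ just v
  row-cell p q rewrite p = q

-- Each step of a slide raises `r + c` by one while the hole stays in the grid, so this bound shows
-- that `cells g` is enough fuel.
cell-bound : ∀ {g r c v} → cell g r c ≡ just v → r + c < cells g
cell-bound {g} {r} {c} eq with cell-row {g} {r} eq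
... | row , p , q = +-mono-≤ (nth-< g p) (≤-trans (<⇒≤ (nth-< row q)) (longest g p))
  where
  longest : ∀ g {r row} → nth g r ≡ just row → length row ≤ sum (map length g)
  longest (_ ∷ g) {zero}  refl = m≤m+n _ _
  longest (x ∷ g) {suc r} p    = ≤-trans (longest g p) (m≤n+m _ (length x))

nth-ext : ∀ {A : Set} (xs ys : List A) → (∀ n → nth xs n ≡ nth ys n) → xs ≡ ys
nth-ext []       []       eq = refl
nth-ext []       (y ∷ ys) eq with () ← eq 0
nth-ext (x ∷ xs) []       eq with () ← eq 0
nth-ext (x ∷ xs) (y ∷ ys) eq = cong₂ _∷_ (just-injective (eq 0)) (nth-ext xs ys (eq ∘ suc))

opaque
  unfolding cell

  cell-ext : ∀ g h → length g ≡ length h → (∀ r c → cell g r c ≡ cell h r c) → g ≡ h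
  cell-ext []      []      _  _  = refl
  cell-ext (x ∷ g) (y ∷ h) ln eq =
    cong₂ _∷_ (nth-ext x y (eq 0)) (cell-ext g h (suc-injective ln) (λ r → eq (suc r)))

-- Relabelling of entries

opaque
  mapGrid : (ℕ → ℕ) → Grid → Grid
  mapGrid f = map (map (Maybe.map f))

nth-map : ∀ {A B : Set} (f : A → B) xs n → nth (map f xs) n ≡ Maybe.map f (nth xs n)
nth-map f []       n       = refl
nth-map f (x ∷ xs) zero    = refl
nth-map f (x ∷ xs) (suc n) = nth-map f xs n

upd-map : ∀ {A B : Set} {f : A → B} {h : A → A} {k : B → B} → (∀ x → f (h x) ≡ k (f x)) →
          ∀ n xs → map f (upd h n xs) ≡ upd k n (map f xs)
upd-map eq n       []       = refl
upd-map eq zero    (x ∷ xs) = cong (_∷ _) (eq x)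
upd-map eq (suc n) (x ∷ xs) = cong (_ ∷_) (upd-map eq n xs)

opaque
  unfolding mapGrid cell

  cell-mapGrid : ∀ f g r c → cell (mapGrid f g) r c ≡ Maybe.map (Maybe.map f) (cell g r c)
  cell-mapGrid f g r c rewrite nth-map (map (Maybe.map f)) g r with nth g r
  ... | nothing  = refl
  ... | just row = nth-map (Maybe.map f) row c

  get-mapGrid : ∀ f g r c → get (mapGrid f g) r c ≡ Maybe.map f (get g r c)
  get-mapGrid f g r c rewrite nth-map (map (Maybe.map f)) g r with nth g r
  ... | nothing  = refl
  ... | just row rewrite nth-map (Maybe.map f) row c with nth row c
  ...   | nothing = refl
  ...   | just _  = refl

  mapGrid-set : ∀ f g r c v → mapGrid f (set g r c v) ≡ set (mapGrid f g) r c (Maybe.map f v)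
  mapGrid-set f g r c v = upd-map (upd-map (λ _ → refl) c) r g

  mapGrid-cut : ∀ f g r c → mapGrid f (upd (take c) r g) ≡ upd (take c) r (mapGrid f g)
  mapGrid-cut f g r c = upd-map (take-map c) r g
    where
    take-map : ∀ n xs → map (Maybe.map f) (take n xs) ≡ take n (map (Maybe.map f) xs)
    take-map zero    xs       = refl
    take-map (suc n) []       = refl
    take-map (suc n) (x ∷ xs) = cong (_ ∷_) (take-map n xs)

  length-mapGrid : ∀ f g → length (mapGrid f g) ≡ length g
  length-mapGrid f g = length-map _ g

  mapGrid-lengths : ∀ f g → map length (mapGrid f g) ≡ map length g
  mapGrid-lengths f []      = refl
  mapGrid-lengths f (x ∷ g) = cong₂ _∷_ (length-map _ x) (mapGrid-lengths f g)

  cells-mapGrid : ∀ f g → cells (mapGrid f g) ≡ cells g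
  cells-mapGrid f g = cong₂ _+_ (length-map _ g) (cong sum (mapGrid-lengths f g))

  leading-map : ∀ f xs → leading (map (Maybe.map f) xs) ≡ leading xs
  leading-map f []             = refl
  leading-map f (nothing ∷ xs) = cong suc (leading-map f xs)
  leading-map f (just _ ∷ xs)  = refl

  findCorner-mapGrid : ∀ f g → findCorner (mapGrid f g) ≡ findCorner g
  findCorner-mapGrid f []      = refl
  findCorner-mapGrid f (x ∷ g) rewrite findCorner-mapGrid f g with findCorner g
  ... | just _  = refl
  ... | nothing rewrite leading-map f x = refl

entry-mapGrid⁻ : ∀ {f g r c y} → cell (mapGrid f g) r c ≡ entry y → ∃ λ x → cell g r c ≡ entry x × y ≡ f x
entry-mapGrid⁻ {f} {g} {r} {c} eq rewrite cell-mapGrid f g r c with cell g r c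
entry-mapGrid⁻ refl | entry x = x , refl , refl

just-mapGrid : ∀ {f g r c v} → cell g r c ≡ just v → cell (mapGrid f g) r c ≡ just (Maybe.map f v)
just-mapGrid {f} {g} {r} {c} eq rewrite cell-mapGrid f g r c | eq = refl

blank-mapGrid⁻ : ∀ {f g r c} → cell (mapGrid f g) r c ≡ blank → cell g r c ≡ blank
blank-mapGrid⁻ {f} {g} {r} {c} eq rewrite cell-mapGrid f g r c with cell g r c
blank-mapGrid⁻ refl | blank = refl

just-mapGrid⁻ : ∀ {f g r c w} → cell (mapGrid f g) r c ≡ just w → ∃ λ v → cell g r c ≡ just v
just-mapGrid⁻ {f} {g} {r} {c} eq rewrite cell-mapGrid f g r c with cell g r c
... | just v = v , refl

-- Adjacent transpositions

-- Written exactly as the local function of `swapEntries`, so that the two agree by `refl`.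
transposition : ℕ → ℕ → ℕ → ℕ
transposition x y z = if z ≡ᵇ x then y else (if z ≡ᵇ y then x else z)

opaque
  adj : ℕ → ℕ → ℕ
  adj u = transposition u (suc u)

  adj-lower : ∀ u → adj u u ≡ suc u
  adj-lower u rewrite dec-true (u ≟ u) refl = refl

  adj-upper : ∀ u → adj u (suc u) ≡ u
  adj-upper u rewrite dec-false (suc u ≟ u) 1+n≢n | dec-true (suc u ≟ suc u) refl = refl

  adj-other : ∀ {u z} → z ≢ u → z ≢ suc u → adj u z ≡ z
  adj-other {u} {z} p q rewrite dec-false (z ≟ u) p | dec-false (z ≟ suc u) q = refl

data AdjView (u : ℕ) : ℕ → Set where
  lower : AdjView u u
  upper : AdjView u (suc u)
  other : ∀ {z} → z ≢ u → z ≢ suc u → AdjView u z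

adjView : ∀ u z → AdjView u z
adjView u z with z ≟ u | z ≟ suc u
... | yes refl | _        = lower
... | no _     | yes refl = upper
... | no p     | no q     = other p q

adj-involutive : ∀ u z → adj u (adj u z) ≡ z
adj-involutive u z with adjView u z
... | lower     rewrite adj-lower u = adj-upper u
... | upper     rewrite adj-upper u = adj-lower u
... | other p q rewrite adj-other p q = adj-other p q

adj-injective : ∀ {u x y} → adj u x ≡ adj u y → x ≡ y
adj-injective {u} {x} {y} eq = trans (sym (adj-involutive u x)) (trans (cong (adj u) eq) (adj-involutive u y))

-- Relabelling can thus affect a slide step, or the validity of a grid, only where `u` is compared
-- with `u + 1`.
adj-< : ∀ {u x y} → x < y → adj u x < adj u y ⊎ (x ≡ u × y ≡ suc u)
adj-< {u} {x} {y} lt with adjView u x | adjView u y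
... | lower | lower = contradiction lt (<-irrefl refl)
... | lower | upper = inj₂ (refl , refl)
... | lower | other p q rewrite adj-lower u | adj-other p q = inj₁ (≤∧≢⇒< lt (q ∘ sym))
... | upper | lower = contradiction lt (≤⇒≯ (n≤1+n u))
... | upper | upper = contradiction lt (<-irrefl refl)
... | upper | other p q rewrite adj-upper u | adj-other p q = inj₁ (<-trans (n<1+n u) lt)
... | other p q | lower rewrite adj-lower u | adj-other p q = inj₁ (<-trans lt (n<1+n u))
... | other p q | upper rewrite adj-upper u | adj-other p q = inj₁ (≤∧≢⇒< (≤-pred lt) p)
... | other p q | other p' q' rewrite adj-other p q | adj-other p' q' = inj₁ lt

mapGrid-involutive : ∀ u g → mapGrid (adj u) (mapGrid (adj u) g) ≡ g
mapGrid-involutive u g = cell-ext _ g (trans (length-mapGrid _ (mapGrid (adj u) g)) (length-mapGrid _ g)) λ r c →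
  trans (cell-mapGrid (adj u) (mapGrid (adj u) g) r c)
        (trans (cong (Maybe.map (Maybe.map (adj u))) (cell-mapGrid (adj u) g r c)) (twice (cell g r c)))
  where
  twice : ∀ m → Maybe.map (Maybe.map (adj u)) (Maybe.map (Maybe.map (adj u)) m) ≡ m
  twice nothing   = refl
  twice blank     = refl
  twice (entry x) = cong (just ∘ just) (adj-involutive u x)

row-adj : ∀ {g a u} x → InRow (cell g) a x → InRow (cell (mapGrid (adj u) g)) a (adj u x)
row-adj x (c , p) = c , just-mapGrid p

row-lower : ∀ {g a u} → InRow (cell g) a u → InRow (cell (mapGrid (adj u) g)) a (suc u)
row-lower {u = u} p = subst (InRow (cell _) _) (adj-lower u) (row-adj u p)

row-upper : ∀ {g a u} → InRow (cell g) a (suc u) → InRow (cell (mapGrid (adj u) g)) a u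
row-upper {u = u} p = subst (InRow (cell _) _) (adj-upper u) (row-adj (suc u) p)

row-other : ∀ {g a u x} → x ≢ u → x ≢ suc u → InRow (cell g) a x → InRow (cell (mapGrid (adj u) g)) a x
row-other ne ne' p = subst (InRow (cell _) _) (adj-other ne ne') (row-adj _ p)

-- Slides

moveEntry : Grid → ℕ → ℕ → ℕ → ℕ → ℕ → Grid
moveEntry g r c r₂ c₂ x = set (set g r c (just x)) r₂ c₂ nothing

moveEntry-move : ∀ {g r c r₂ c₂ x} → ¬ At r c r₂ c₂ → cell g r c ≡ blank → cell g r₂ c₂ ≡ entry x →
                 Move (cell g) (cell (moveEntry g r c r₂ c₂ x)) r c r₂ c₂ x
moveEntry-move {g} {r} {c} {r₂} {c₂} {x} ne p q = record
  { source = q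
  ; target = p
  ; filled-target = trans (cell-set-≢ {set g r c (just x)} nothing λ (a , b) → ne (sym a , sym b)) (cell-set-≡ {g} (just x) p)
  ; empty-source  = cell-set-≡ {set g r c (just x)} nothing (trans (cell-set-≢ {g} (just x) ne) q)
  ; same = λ ¬A ¬B → trans (cell-set-≢ {set g r c (just x)} nothing ¬B) (cell-set-≢ {g} (just x) ¬A)
  }

-- The comparison is conditional on the presence of the other neighbour, so that each constructor
-- covers two cases of `slide`.
data Step (g : Grid) (r c : ℕ) : Grid → ℕ → ℕ → Set where
  right : ∀ {x} → get g r (suc c) ≡ just x → (∀ y → get g (suc r) c ≡ just y → x < y) →
          Step g r c (moveEntry g r c r (suc c) x) r (suc c)
  down  : ∀ {y} → get g (suc r) c ≡ just y → (∀ x → get g r (suc c) ≡ just x → x ≮ y) →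
          Step g r c (moveEntry g r c (suc r) c y) (suc r) c

step-slide : ∀ {f g r c g₁ r₁ c₁} → Step g r c g₁ r₁ c₁ → slide (suc f) r c g ≡ slide f r₁ c₁ g₁
step-slide {g = g} {r} {c} (right {x} eq lt) rewrite eq with get g (suc r) c
... | nothing = refl
... | just y rewrite dec-true (x <? y) (lt y refl) = refl
step-slide {g = g} {r} {c} (down {y} eq ge) rewrite eq with get g r (suc c)
... | nothing = refl
... | just x rewrite dec-false (x <? y) (ge x refl) = refl

step-cells : ∀ {g r c g₁ r₁ c₁} → Step g r c g₁ r₁ c₁ → cells g₁ ≡ cells g
step-cells {g} {r} {c} (right {x} _ _) = trans (cells-set (set g r c (just x)) r (suc c) nothing) (cells-set g r c (just x))
step-cells {g} {r} {c} (down {y} _ _)  = trans (cells-set (set g r c (just y)) (suc r) c nothing) (cells-set g r c (just y))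

step-diagonal : ∀ {g r c g₁ r₁ c₁} → Step g r c g₁ r₁ c₁ → r₁ + c₁ ≡ suc (r + c)
step-diagonal (right _ _) = +-suc _ _
step-diagonal (down _ _)  = refl

module _ {g r c} (V : Valid (cell g) (At r c)) where

  right-move : ∀ {x} → get g r (suc c) ≡ just x → Move (cell g) (cell (moveEntry g r c r (suc c) x)) r c r (suc c) x
  right-move eq = moveEntry-move (λ { (_ , ()) }) (hole V (refl , refl)) (get-entry {g} eq)

  down-move : ∀ {x} → get g (suc r) c ≡ just x → Move (cell g) (cell (moveEntry g r c (suc r) c x)) r c (suc r) c x
  down-move eq = moveEntry-move (λ { (() , _) }) (hole V (refl , refl)) (get-entry {g} eq)

  -- If the column has an entry below the hole, the cell directly below the hole is filled too and
  -- holds the least of them.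
  below-right : ∀ {x} → (∀ y → get g (suc r) c ≡ just y → x < y) →
                ∀ {r₀ z} → r < r₀ → cell g r₀ c ≡ entry z → x < z
  below-right lt r< p with range V p r< ≤-refl
  ... | _ , e with filled V e (λ { (() , _) }) (n≤1+n r) ≤-refl (inj₁ (refl , refl)) | m≤n⇒m<n∨m≡n r<
  ... | _ , e' | inj₁ r<' = <-trans (lt _ (cell-get e')) (colIncr V e' p r<')
  ... | _ , e' | inj₂ refl = lt _ (cell-get p)

  beside-down : ∀ {y} → get g (suc r) c ≡ just y → (∀ x → get g r (suc c) ≡ just x → x ≮ y) →
                ∀ {c₀ z} → c < c₀ → cell g r c₀ ≡ entry z → y < z
  beside-down {y} eq ge c< p with range V p ≤-refl c<
  ... | _ , e with filled V e (λ { (_ , ()) }) ≤-refl (n≤1+n c) (inj₁ (refl , refl)) | m≤n⇒m<n∨m≡n c<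
  ... | x , e' | c<' = <-≤-trans y<x (x≤ c<')
    where
    y<x : y < x
    -- `slide` would also go down for equal neighbours; distinctness makes the comparison strict.
    y<x = ≤∧≢⇒< (≮⇒≥ (ge x (cell-get e'))) λ { refl → 1+n≢n (proj₁ (distinct V (get-entry {g} eq) e')) }
    x≤ : _ → x ≤ _
    x≤ (inj₁ lt)   = <⇒≤ (rowIncr V e' p lt)
    x≤ (inj₂ refl) = ≤-reflexive (entry-injective (trans (sym e') p))

  step-valid : ∀ {g₁ r₁ c₁} → Step g r c g₁ r₁ c₁ → Valid (cell g₁) (At r₁ c₁)
  step-valid (right eq lt) = move-right-valid V (right-move eq) (below-right lt)
  step-valid (down eq ge)  = move-down-valid V (down-move eq) (beside-down eq ge)

  step-descent : ∀ {g₁ r₁ c₁} → Step g r c g₁ r₁ c₁ → ∀ {x} → Descent (cell g) x → Descent (cell g₁) x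
  step-descent (right eq lt) (_ , _ , p , q , rel) =
    _ , _ , move-right-row V (right-move eq) p , move-right-row V (right-move eq) q , rel
  step-descent (down eq ge) = move-down-descent V (down-move eq) (beside-down eq ge)

  step-ascent : ∀ {g₁ r₁ c₁} → Step g r c g₁ r₁ c₁ → ∀ {x} → Ascent (cell g) x → Ascent (cell g₁) x
  step-ascent (right eq lt) (_ , _ , p , q , rel) =
    _ , _ , move-right-row V (right-move eq) p , move-right-row V (right-move eq) q , rel
  step-ascent (down eq ge) = move-down-ascent V (down-move eq) (beside-down eq ge)

module _ (g : Grid) (r c : ℕ) where

  data Next : Set where
    stop : get g r (suc c) ≡ nothing → get g (suc r) c ≡ nothing → Next
    go   : ∀ {g₁ r₁ c₁} → Step g r c g₁ r₁ c₁ → Next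

  next : Next
  next with get g r (suc c) in eqR | get g (suc r) c in eqD
  ... | nothing | nothing = stop eqR eqD
  ... | just x  | nothing = go (right eqR λ y eq → case trans (sym eqD) eq of λ ())
  ... | nothing | just y  = go (down eqD λ x eq → case trans (sym eqR) eq of λ ())
  ... | just x  | just y with x <? y
  ...   | yes lt = go (right eqR λ y' eq → subst (x <_) (just-injective (trans (sym eqD) eq)) lt)
  ...   | no ¬lt = go (down eqD λ x' eq lt → ¬lt (subst (_< y) (just-injective (trans (sym eq) eqR)) lt))

-- The end of a slide

stop-slide : ∀ {f g r c} → get g r (suc c) ≡ nothing → get g (suc r) c ≡ nothing →
             slide (suc f) r c g ≡ upd (take c) r g
stop-slide p q rewrite p | q = refl

nth-take-< : ∀ {A : Set} (xs : List A) {n c} → c < n → nth (take n xs) c ≡ nth xs c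
nth-take-< []       {suc n}          lt       = refl
nth-take-< (x ∷ xs) {suc n} {zero}   lt       = refl
nth-take-< (x ∷ xs) {suc n} {suc c}  (s≤s lt) = nth-take-< xs lt

nth-take-≥ : ∀ {A : Set} (xs : List A) {n c} → n ≤ c → nth (take n xs) c ≡ nothing
nth-take-≥ xs       {zero}           z≤n     = refl
nth-take-≥ []       {suc n} {suc c}  le       = refl
nth-take-≥ (x ∷ xs) {suc n} {suc c}  (s≤s le) = nth-take-≥ xs le

opaque
  unfolding cell

  cell-cut-other : ∀ {g r c a b} → ¬ (a ≡ r × c ≤ b) → cell (upd (take c) r g) a b ≡ cell g a b
  cell-cut-other {g} {r} {c} {a} {b} ne with a ≟ r
  ... | no a≢ rewrite nth-upd-≢ (take c) g a≢ = refl
  ... | yes refl rewrite nth-upd-≡ (take c) r g with nth g r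
  ...   | nothing  = refl
  ...   | just row = nth-take-< row (≰⇒> λ le → ne (refl , le))

  cell-cut : ∀ {g r c b} → c ≤ b → cell (upd (take c) r g) r b ≡ nothing
  cell-cut {g} {r} {c} le rewrite nth-upd-≡ (take c) r g with nth g r
  ... | nothing  = refl
  ... | just row = nth-take-≥ row le

module _ {g r c} (V : Valid (cell g) (At r c))
         (endR : get g r (suc c) ≡ nothing) (endD : get g (suc r) c ≡ nothing) where

  private
    cut : Grid
    cut = upd (take c) r g

    outside : ∀ {a b v} → r ≤ a → c ≤ b → ¬ At r c a b → get g a b ≡ nothing → cell g a b ≡ just v → ⊥
    outside r≤ c≤ ne end p with get-nothing {g} end
    ... | inj₁ q = case trans (sym p) q of λ ()
    ... | inj₂ q = proj₂ (inner V q ne r≤ c≤) (refl , refl)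

    -- Any further cell below or right of the hole would put a neighbour of the hole into the shape.
    -- That neighbour holds no entry, and as an inner cell it would make the hole inner as well.
    -- Hence cutting the row at the hole removes nothing else.
    beyond : ∀ {a b v} → cell g a b ≡ just v → r ≤ a → c ≤ b → At r c a b
    beyond {a} {b} p r≤ c≤ with m≤n⇒m<n∨m≡n r≤ | m≤n⇒m<n∨m≡n c≤
    ... | inj₁ r< | _ = ⊥-elim (outside (n≤1+n r) ≤-refl (λ { (() , _) }) endD (proj₂ (range V p r< c≤)))
    ... | inj₂ refl | inj₁ c< = ⊥-elim (outside ≤-refl (n≤1+n c) (λ { (_ , ()) }) endR (proj₂ (range V p ≤-refl c<)))
    ... | inj₂ refl | inj₂ refl = refl , refl

    cut-defined : ∀ {a b v} → cell cut a b ≡ just v → cell g a b ≡ just v × ¬ (a ≡ r × c ≤ b)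
    cut-defined {a} {b} p with a ≟ r | c ≤? b
    ... | yes refl | yes le = case trans (sym p) (cell-cut {g} le) of λ ()
    ... | no ne    | _      = trans (sym (cell-cut-other (ne ∘ proj₁))) p , ne ∘ proj₁
    ... | yes refl | no nle = trans (sym (cell-cut-other (nle ∘ proj₂))) p , nle ∘ proj₂

  cut-valid : Valid (cell cut) Nowhere
  cut-valid = record
    { range    = rng
    ; inner    = inn
    ; hole     = λ ()
    ; rowIncr  = λ p q → rowIncr V (proj₁ (cut-defined p)) (proj₁ (cut-defined q))
    ; colIncr  = λ p q → colIncr V (proj₁ (cut-defined p)) (proj₁ (cut-defined q))
    ; distinct = λ p q → distinct V (proj₁ (cut-defined p)) (proj₁ (cut-defined q))
    }
    where
    rng : ∀ {a b a' b' v} → cell cut a b ≡ just v → a' ≤ a → b' ≤ b → ∃ λ v' → cell cut a' b' ≡ just v'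
    rng p a≤ b≤ with cut-defined p
    ... | q , ne with range V q a≤ b≤
    ...   | v' , q' = v' , trans (cell-cut-other λ { (refl , le) → in-cut a≤ (≤-trans le b≤) }) q'
      where
      in-cut : r ≤ _ → c ≤ _ → ⊥
      in-cut r≤ c≤ with beyond q r≤ c≤
      ... | refl , refl = ne (refl , ≤-refl)
    inn : ∀ {a b a' b'} → cell cut a b ≡ blank → ¬ Nowhere a b → a' ≤ a → b' ≤ b → cell cut a' b' ≡ blank × ¬ Nowhere a' b'
    inn p _ a≤ b≤ with cut-defined p
    ... | q , ne with inner V q (λ { (refl , refl) → ne (refl , ≤-refl) }) a≤ b≤ | rng p a≤ b≤
    ...   | q' , _ | _ , e = trans e (trans (sym (proj₁ (cut-defined e))) q') , λ ()

  cut-row : ∀ {a x} → InRow (cell g) a x → InRow (cell cut) a x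
  cut-row (b , p) = b , trans (cell-cut-other λ { (refl , le) → entry≢blank p (hole V (beyond p ≤-refl le)) }) p

-- Elementary dual equivalences on grids

Exchange : ℕ → Grid → Grid → Set
Exchange p g g' =
  (Descent (cell g) p × Ascent (cell g) (suc p) × Ascent (cell g') p × Descent (cell g') (suc p)) ⊎
  (Ascent (cell g) p × Descent (cell g) (suc p) × Descent (cell g') p × Ascent (cell g') (suc p))

-- A nontrivial move d_i with i = p + 1, recognised by the descents at i − 1 and i.
record Dual (p : ℕ) (g g' : Grid) : Set where
  constructor dual
  field
    lowest   : ℕ
    choice   : lowest ≡ p ⊎ lowest ≡ suc p
    relabel  : g' ≡ mapGrid (adj lowest) g
    exchange : Exchange p g g'

exchange-sym : ∀ {p g g'} → Exchange p g g' → Exchange p g' g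
exchange-sym (inj₁ (a , b , c , d)) = inj₂ (c , d , a , b)
exchange-sym (inj₂ (a , b , c , d)) = inj₁ (c , d , a , b)

dual-sym : ∀ {p g g'} → Dual p g g' → Dual p g' g
dual-sym {g = g} (dual u ch refl ex) = dual u ch (sym (mapGrid-involutive u g)) (exchange-sym ex)

dual-cong : ∀ {p g g' h h'} → g ≡ h → g' ≡ h' → Dual p h h' → Dual p g g'
dual-cong refl refl D = D

-- The two steps may start at different holes, as they must while the slides are separated.
exchange-step : ∀ {p g g' r c r' c' g₁ g₁' r₁ c₁ r₁' c₁'} → Valid (cell g) (At r c) → Valid (cell g') (At r' c') →
                Step g r c g₁ r₁ c₁ → Step g' r' c' g₁' r₁' c₁' → Exchange p g g' → Exchange p g₁ g₁'
exchange-step V V' s s' (inj₁ (a , b , c , d)) =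
  inj₁ (step-descent V s a , step-ascent V s b , step-ascent V' s' c , step-descent V' s' d)
exchange-step V V' s s' (inj₂ (a , b , c , d)) =
  inj₂ (step-ascent V s a , step-descent V s b , step-descent V' s' c , step-ascent V' s' d)

-- Simultaneous slides of a grid and its relabelling

mapGrid-moveEntry : ∀ f g r c r₂ c₂ x →
                    mapGrid f (moveEntry g r c r₂ c₂ x) ≡ moveEntry (mapGrid f g) r c r₂ c₂ (f x)
mapGrid-moveEntry f g r c r₂ c₂ x =
  trans (mapGrid-set f (set g r c (just x)) r₂ c₂ nothing)
        (cong (λ h → set h r₂ c₂ nothing) (mapGrid-set f g r c (just x)))

data Together (u : ℕ) (g : Grid) (r c : ℕ) : Set where
  both  : ∀ {g₁ r₁ c₁} → Step g r c g₁ r₁ c₁ → Step (mapGrid (adj u) g) r c (mapGrid (adj u) g₁) r₁ c₁ → Together u g r c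
  apart : get g r (suc c) ≡ just u → get g (suc r) c ≡ just (suc u) → Together u g r c
  apart⁻ : get g r (suc c) ≡ just (suc u) → get g (suc r) c ≡ just u → Together u g r c

get-relabel : ∀ {f g r c x} → get g r c ≡ just x → get (mapGrid f g) r c ≡ just (f x)
get-relabel {f} {g} {r} {c} eq = trans (get-mapGrid f g r c) (cong (Maybe.map f) eq)

get-relabel⁻ : ∀ {f g r c y} → get (mapGrid f g) r c ≡ just y → ∃ λ x → get g r c ≡ just x × y ≡ f x
get-relabel⁻ {f} {g} {r} {c} eq with get g r c | trans (sym (get-mapGrid f g r c)) eq
... | just x | refl = x , refl , refl

-- A step depends only on the order of the two neighbours of the hole, which the relabelling
-- reverses only if they are `u` and `u + 1`.
together : ∀ {u g r c g₁ r₁ c₁} → Valid (cell g) (At r c) → Step g r c g₁ r₁ c₁ → Together u g r c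
together {u} {g} {r} {c} V (right {x} eq lt) = decide _ refl
  where
  same-step : (∀ y → get g (suc r) c ≡ just y → adj u x < adj u y) → Together u g r c
  same-step lt' = both (right eq lt) (subst (λ h → Step (mapGrid (adj u) g) r c h r (suc c))
    (sym (mapGrid-moveEntry (adj u) g r c r (suc c) x))
    (right (get-relabel {g = g} eq) λ _ e → let y , e' , y≡ = get-relabel⁻ {g = g} e in subst (_ <_) (sym y≡) (lt' y e')))
  decide : ∀ m → get g (suc r) c ≡ m → Together u g r c
  decide nothing  eqD = same-step λ _ e → case trans (sym eqD) e of λ ()
  decide (just y) eqD with adj-< {u} (lt y eqD)
  ... | inj₁ lt' = same-step λ y' e → subst (λ z → adj u x < adj u z) (just-injective (trans (sym eqD) e)) lt'
  ... | inj₂ (refl , refl) = apart eq eqD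
together {u} {g} {r} {c} V (down {y} eq ge) = decide _ refl
  where
  same-step : (∀ x → get g r (suc c) ≡ just x → adj u x ≮ adj u y) → Together u g r c
  same-step ge' = both (down eq ge) (subst (λ h → Step (mapGrid (adj u) g) r c h (suc r) c)
    (sym (mapGrid-moveEntry (adj u) g r c (suc r) c y))
    (down (get-relabel {g = g} eq) λ _ e → let x , e' , x≡ = get-relabel⁻ {g = g} e in subst (_≮ _) (sym x≡) (ge' x e')))
  decide : ∀ m → get g r (suc c) ≡ m → Together u g r c
  decide nothing  eqR = same-step λ _ e → case trans (sym eqR) e of λ ()
  decide (just x) eqR with adj-< {u} (beside-down V eq ge (n<1+n c) (get-entry {g} eqR))
  ... | inj₁ lt' = same-step λ x' e → subst (λ z → adj u z ≮ adj u y) (just-injective (trans (sym eqR) e)) (<⇒≯ lt')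
  ... | inj₂ (refl , refl) = apart⁻ eqR eq

-- Being less than `x`, the entry `p` lies left of the hole; the entry directly below it is then
-- greater than `p` and left of `y`.
left-of-hole : ∀ {F r c p x y} → Valid F (At r c) → F r (suc c) ≡ entry x → F (suc r) c ≡ entry y →
               InRow F r p → p < x → ∃₂ λ b z → F (suc r) b ≡ entry z × p < z × z < y
left-of-hole {c = c} V px py (b , p) lt with <-cmp b c
... | tri≈ _ refl _ = entry≢blank p (hole V (refl , refl))
... | tri< b< _ _ with filled V (proj₂ (range V py ≤-refl (<⇒≤ b<))) (λ { (() , _) }) (n≤1+n _) ≤-refl (inj₂ (_ , p))
...   | z , e = b , z , e , colIncr V p e (n<1+n _) , rowIncr V e py b<
left-of-hole V px py (b , p) lt | tri> _ _ b> with m≤n⇒m<n∨m≡n b>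
... | inj₁ b>' = contradiction lt (<⇒≯ (rowIncr V px p b>'))
... | inj₂ refl = contradiction lt (<-irrefl (entry-injective (trans (sym p) px)))

module _ {p g r c} (V : Valid (cell g) (At r c)) (V' : Valid (cell (mapGrid (adj (suc p)) g)) (At r c)) where

  private
    fixed : ∀ {a} → InRow (cell g) a p → InRow (cell (mapGrid (adj (suc p)) g)) a p
    fixed = row-other (1+n≢n ∘ sym) (<⇒≢ (m<n+m p {2} (s≤s z≤n)))

  -- The exchange forces `p` into row `r`, left of the hole. The entry below it lies strictly
  -- between `p` and `p + 2`, so it would be `p + 1`, which stands in row `r`.
  upper-not-apart : Exchange p g (mapGrid (adj (suc p)) g) →
    get g r (suc c) ≡ just (suc p) → get g (suc r) c ≡ just (suc (suc p)) → ⊥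
  upper-not-apart (inj₁ (_ , as , _)) eqR eqD = ascent-descent V as (_ , _ , (_ , get-entry {g} eqR) , (_ , get-entry {g} eqD) , n<1+n r)
  upper-not-apart (inj₂ ((a , _ , pa , pb , le) , _ , (_ , _ , pa' , pb' , lt) , _)) eqR eqD
    with refl ← row-unique V' pa' (fixed pa)
       | refl ← row-unique V' pb' (row-upper (_ , get-entry {g} eqD))
       | refl ← row-unique V pb (_ , get-entry {g} eqR)
    with refl ← ≤-antisym le (≤-pred lt)
    with left-of-hole V (get-entry {g} eqR) (get-entry {g} eqD) pa (n<1+n p)
  ... | _ , z , e , lo , hi with refl ← ≤-antisym lo (≤-pred hi) =
    1+n≢n (proj₁ (distinct V e (get-entry {g} eqR)))

  -- Again `p` is forced into row `r`; now the entry below it would lie strictly between `p` and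
  -- `p + 1`.
  upper-not-apart⁻ : Exchange p g (mapGrid (adj (suc p)) g) →
    get g r (suc c) ≡ just (suc (suc p)) → get g (suc r) c ≡ just (suc p) → ⊥
  upper-not-apart⁻ (inj₂ (_ , ds , _)) eqR eqD = ascent-descent V (_ , _ , (_ , get-entry {g} eqD) , (_ , get-entry {g} eqR) , n≤1+n r) ds
  upper-not-apart⁻ (inj₁ ((a , _ , pa , pb , lt) , _ , (_ , _ , pa' , pb' , le) , _)) eqR eqD
    with refl ← row-unique V' pa' (fixed pa)
       | refl ← row-unique V' pb' (row-upper (_ , get-entry {g} eqR))
       | refl ← row-unique V pb (_ , get-entry {g} eqD)
    with refl ← ≤-antisym le (≤-pred lt)
    with left-of-hole V (get-entry {g} eqR) (get-entry {g} eqD) pa (<-trans (n<1+n p) (n<1+n _))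
  ... | _ , z , e , lo , hi = <⇒≱ hi lo

-- The slides of g and g' part at a square with p + 1 right of the hole, p below
-- it and p + 2 diagonally opposite, and meet again two steps later; from then on
-- p + 1 and p + 2 are the interchanged entries instead of p and p + 1.
module Rejoin {p g r c} (V : Valid (cell g) (At r c)) (V' : Valid (cell (mapGrid (adj p) g)) (At r c))
              (ex : Exchange p g (mapGrid (adj p) g))
              (eqR : get g r (suc c) ≡ just (suc p)) (eqD : get g (suc r) c ≡ just p) where

  private
    g' : Grid
    g' = mapGrid (adj p) g

    inRight : cell g r (suc c) ≡ entry (suc p)
    inRight = get-entry {g} eqR

    inBelow : cell g (suc r) c ≡ entry p
    inBelow = get-entry {g} eqD

    -- The exchange forces `p + 2` into row `r + 1`, where it lies right of `p`. If it were not
    -- adjacent, the next cell after `p` would hold `p + 1`, which stands in row `r`.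
    inDiagonal : cell g (suc r) (suc c) ≡ entry (suc (suc p))
    inDiagonal = diagonal ex
      where
      diagonal : Exchange p g g' → cell g (suc r) (suc c) ≡ entry (suc (suc p))
      diagonal (inj₁ (ds , _)) = ascent-descent V (_ , _ , (_ , inBelow) , (_ , inRight) , n≤1+n r) ds
      diagonal (inj₂ (_ , (_ , b , qa , qb , lt) , _ , (_ , _ , qa' , qb' , le)))
        with refl ← row-unique V qa (_ , inRight)
           | refl ← row-unique V' qa' (row-lower (_ , inBelow))
           | refl ← row-unique V' qb' (row-other (λ ()) 1+n≢n qb)
        with refl ← ≤-antisym le lt
        with qb
      ... | b , q with <-cmp b (suc c)
      ...   | tri≈ _ refl _ = q
      ...   | tri> _ _ b>
        with filled V (proj₂ (range V q ≤-refl (<⇒≤ b>))) (λ { (() , _) }) ≤-refl (n≤1+n c) (inj₂ (_ , inBelow))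
      ...     | z , e with refl ← ≤-antisym (rowIncr V inBelow e (n<1+n c)) (≤-pred (rowIncr V e q b>)) =
        contradiction (proj₁ (distinct V e inRight)) 1+n≢n
      diagonal (inj₂ _) | b , q | tri< b< _ _
        with m≤n⇒m<n∨m≡n (≤-pred b<)
      ... | inj₁ b<' = contradiction (rowIncr V q inBelow b<') (<⇒≯ (m<n+m p {2} (s≤s z≤n)))
      ... | inj₂ refl = contradiction (entry-injective (trans (sym inBelow) q)) (<⇒≢ (m<n+m p {2} (s≤s z≤n)))

    inRight' : cell g' r (suc c) ≡ entry p
    inRight' = trans (just-mapGrid inRight) (cong (just ∘ just) (adj-upper p))

    inBelow' : cell g' (suc r) c ≡ entry (suc p)
    inBelow' = trans (just-mapGrid inBelow) (cong (just ∘ just) (adj-lower p))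

    inDiagonal' : cell g' (suc r) (suc c) ≡ entry (suc (suc p))
    inDiagonal' = trans (just-mapGrid inDiagonal) (cong (just ∘ just) (adj-other (λ ()) 1+n≢n))

  -- One slide goes down and then right, the other right and then down. The square becomes `p`,
  -- `p + 1` over `p + 2` in `g₂` and `p`, `p + 2` over `p + 1` in `g₂'`, with the hole in the
  -- diagonal cell of both.
  g₁ g₂ g₁' g₂' : Grid
  g₁  = moveEntry g r c (suc r) c p
  g₂  = moveEntry g₁ (suc r) c (suc r) (suc c) (suc (suc p))
  g₁' = moveEntry g' r c r (suc c) p
  g₂' = moveEntry g₁' r (suc c) (suc r) (suc c) (suc (suc p))

  private
    move₁ : Move (cell g) (cell g₁) r c (suc r) c p
    move₁ = down-move V eqD

    move₁' : Move (cell g') (cell g₁') r c r (suc c) p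
    move₁' = right-move V' (cell-get inRight')

  step₁ : Step g r c g₁ (suc r) c
  step₁ = down eqD λ x e lt → <⇒≱ lt (≤-trans (n≤1+n p) (≤-reflexive (just-injective (trans (sym eqR) e))))

  step₁' : Step g' r c g₁' r (suc c)
  step₁' = right (cell-get inRight') λ y e → ≤-reflexive (just-injective (trans (sym (cell-get inBelow')) e))

  valid₁ : Valid (cell g₁) (At (suc r) c)
  valid₁ = step-valid V step₁

  valid₁' : Valid (cell g₁') (At r (suc c))
  valid₁' = step-valid V' step₁'

  private
    diagonal₁ : cell g₁ (suc r) (suc c) ≡ entry (suc (suc p))
    diagonal₁ = trans (same move₁ (λ { (() , _) }) (λ { (_ , ()) })) inDiagonal

    diagonal₁' : cell g₁' (suc r) (suc c) ≡ entry (suc (suc p))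
    diagonal₁' = trans (same move₁' (λ { (() , _) }) (λ { (() , _) })) inDiagonal'

    move₂ : Move (cell g₁) (cell g₂) (suc r) c (suc r) (suc c) (suc (suc p))
    move₂ = right-move valid₁ (cell-get diagonal₁)

    move₂' : Move (cell g₁') (cell g₂') r (suc c) (suc r) (suc c) (suc (suc p))
    move₂' = down-move valid₁' (cell-get diagonal₁')

  step₂ : Step g₁ (suc r) c g₂ (suc r) (suc c)
  step₂ = right (cell-get diagonal₁) λ y e → larger y
    (trans (sym (same move₁ (λ { (() , _) }) (λ { (() , _) }))) (get-entry {g₁} e))
    where
    larger : ∀ y → cell g (suc (suc r)) c ≡ entry y → suc (suc p) < y
    -- The entry below `p` exceeds `p`, and the cells of `p + 1` and `p + 2` are known to be others.
    larger y e = ≤∧≢⇒< (≤∧≢⇒< (colIncr V inBelow e (n<1+n _))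
      (λ { refl → <⇒≢ (m<n+m r {2} (s≤s z≤n)) (proj₁ (distinct V inRight e)) }))
      (λ { refl → 1+n≢n (proj₁ (distinct V e inDiagonal)) })

  step₂' : Step g₁' r (suc c) g₂' (suc r) (suc c)
  step₂' = down (cell-get diagonal₁') λ x e → larger x
    (trans (sym (same move₁' (λ { (_ , ()) }) (λ { (_ , ()) }))) (get-entry {g₁'} e))
    where
    larger : ∀ x → cell g' r (suc (suc c)) ≡ entry x → x ≮ suc (suc p)
    -- Between `p` and `p + 2` there is only `p + 1`, which in `g'` stands below the original hole.
    larger x e lt with refl ← ≤-antisym (rowIncr V' inRight' e (n<1+n _)) (≤-pred lt) =
      1+n≢n (proj₁ (distinct V' inBelow' e))

  private
    agree : ∀ a b → cell g₂' a b ≡ cell (mapGrid (adj (suc p)) g₂) a b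
    agree a b with at? r c a b | at? (suc r) c a b | at? r (suc c) a b | at? (suc r) (suc c) a b
    ... | yes (refl , refl) | _ | _ | _ = trans
      (trans (same move₂' (λ { (_ , ()) }) (λ { (() , _) })) (filled-target move₁'))
      (sym (trans (just-mapGrid (trans (same move₂ (λ { (() , _) }) (λ { (() , _) })) (filled-target move₁)))
                  (cong (just ∘ just) (adj-other (1+n≢n ∘ sym) (<⇒≢ (m<n+m p {2} (s≤s z≤n)))))))
    ... | no _ | yes (refl , refl) | _ | _ = trans
      (trans (same move₂' (λ { (() , _) }) (λ { (_ , ()) })) (trans (same move₁' (λ { (() , _) }) (λ { (() , _) })) inBelow'))
      (sym (trans (just-mapGrid (filled-target move₂)) (cong (just ∘ just) (adj-upper (suc p)))))
    ... | no _ | no _ | yes (refl , refl) | _ = trans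
      (filled-target move₂')
      (sym (trans (just-mapGrid (trans (same move₂ (λ { (() , _) }) (λ { (() , _) }))
                                       (trans (same move₁ (λ { (_ , ()) }) (λ { (() , _) })) inRight)))
                  (cong (just ∘ just) (adj-lower (suc p)))))
    ... | no _ | no _ | no _ | yes (refl , refl) = trans (empty-source move₂') (sym (just-mapGrid (empty-source move₂)))
    ... | no ¬A | no ¬C | no ¬B | no ¬D = trans
      (trans (same move₂' ¬B ¬D) (trans (same move₁' ¬A ¬B) (cell-mapGrid (adj p) g a b)))
      (sym (trans (cell-mapGrid (adj (suc p)) g₂ a b)
                  (trans (cong (Maybe.map (Maybe.map (adj (suc p)))) (trans (same move₂ ¬C ¬D) (same move₁ ¬A ¬C)))
                         (elsewhere _ refl))))
      where
      -- The entries `p`, `p + 1`, `p + 2` all lie in the square, so outside it both transpositions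
      -- act as the identity.
      elsewhere : ∀ m → cell g a b ≡ m → Maybe.map (Maybe.map (adj (suc p))) (cell g a b) ≡
                                         Maybe.map (Maybe.map (adj p)) (cell g a b)
      elsewhere nothing   e rewrite e = refl
      elsewhere blank     e rewrite e = refl
      elsewhere (entry z) e rewrite e = cong (just ∘ just) (trans (adj-other z≢sp z≢ssp) (sym (adj-other z≢p z≢sp)))
        where
        z≢p : z ≢ p
        z≢p refl = ¬C (distinct V e inBelow)
        z≢sp : z ≢ suc p
        z≢sp refl = ¬B (distinct V e inRight)
        z≢ssp : z ≢ suc (suc p)
        z≢ssp refl = ¬D (distinct V e inDiagonal)

    length-moveEntry : ∀ h a b a' b' x → length (moveEntry h a b a' b' x) ≡ length h
    length-moveEntry h a b a' b' x = trans (length-upd _ a' (set h a b (just x))) (length-upd _ a h)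

  meet : Dual p g₂ g₂'
  meet = dual (suc p) (inj₂ refl)
    (cell-ext g₂' (mapGrid (adj (suc p)) g₂)
      (trans (trans (length-moveEntry g₁' _ _ _ _ _) (trans (length-moveEntry g' _ _ _ _ _) (length-mapGrid (adj p) g)))
             (sym (trans (length-mapGrid (adj (suc p)) g₂) (trans (length-moveEntry g₁ _ _ _ _ _) (length-moveEntry g _ _ _ _ _)))))
      agree)
    (exchange-step valid₁ valid₁' step₂ step₂' (exchange-step V V' step₁ step₁' ex))

slide-fuel : ∀ f {g r c g₁ r₁ c₁} → Step g r c g₁ r₁ c₁ → cells g ≤ suc f + (r + c) → cells g₁ ≤ f + (r₁ + c₁)
slide-fuel f {r = r} {c} s b rewrite step-cells s | step-diagonal s = ≤-trans b (≤-reflexive (sym (+-suc f (r + c))))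

no-fuel : ∀ {g r c} {A : Set} → Valid (cell g) (At r c) → cells g ≤ r + c → A
no-fuel {g} V b = contradiction (cell-bound {g} (hole V (refl , refl))) (≤⇒≯ b)

slide-valid : ∀ f {g r c} → Valid (cell g) (At r c) → cells g ≤ f + (r + c) → Valid (cell (slide f r c g)) Nowhere
slide-valid zero V b = no-fuel V b
slide-valid (suc f) {g} {r} {c} V b with next g r c
... | stop endR endD = subst (λ h → Valid (cell h) Nowhere) (sym (stop-slide {f} {g} endR endD)) (cut-valid V endR endD)
... | go s = subst (λ h → Valid (cell h) Nowhere) (sym (step-slide {f} s)) (slide-valid f (step-valid V s) (slide-fuel f s b))

slide-dual : ∀ f {p g g' r c} → Valid (cell g) (At r c) → Valid (cell g') (At r c) → Dual p g g' →
             cells g ≤ f + (r + c) → Dual p (slide f r c g) (slide f r c g')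

-- Consumes two steps of each slide at once, since after the first step the holes are in different
-- cells and `Dual` need not hold.
rejoin-dual : ∀ f {p g r c} → Valid (cell g) (At r c) → Valid (cell (mapGrid (adj p) g)) (At r c) →
              Exchange p g (mapGrid (adj p) g) → cells g ≤ suc f + (r + c) →
              get g r (suc c) ≡ just (suc p) → get g (suc r) c ≡ just p →
              Dual p (slide (suc f) r c g) (slide (suc f) r c (mapGrid (adj p) g))

slide-dual zero V V' D b = no-fuel V b
slide-dual (suc f) {p} {g} {r = r} {c} V V' (dual u ch refl ex) b with next g r c
... | stop endR endD =
  dual-cong (stop-slide {f} {g} endR endD) (stop-slide {f} {mapGrid (adj u) g} endR' endD')
    (dual u ch (sym (mapGrid-cut (adj u) g r c)) (cut-exchange ex))
  where
  endR' : get (mapGrid (adj u) g) r (suc c) ≡ nothing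
  endR' = trans (get-mapGrid (adj u) g r (suc c)) (cong (Maybe.map (adj u)) endR)
  endD' : get (mapGrid (adj u) g) (suc r) c ≡ nothing
  endD' = trans (get-mapGrid (adj u) g (suc r) c) (cong (Maybe.map (adj u)) endD)
  kept : ∀ {a x} → InRow (cell g) a x → InRow (cell (upd (take c) r g)) a x
  kept = cut-row V endR endD
  kept' : ∀ {a x} → InRow (cell (mapGrid (adj u) g)) a x → InRow (cell (upd (take c) r (mapGrid (adj u) g))) a x
  kept' = cut-row V' endR' endD'
  cut-exchange : Exchange p g (mapGrid (adj u) g) → Exchange p (upd (take c) r g) (upd (take c) r (mapGrid (adj u) g))
  cut-exchange (inj₁ ((_ , _ , p₁ , q₁ , r₁) , (_ , _ , p₂ , q₂ , r₂) , (_ , _ , p₃ , q₃ , r₃) , (_ , _ , p₄ , q₄ , r₄))) =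
    inj₁ ((_ , _ , kept p₁ , kept q₁ , r₁) , (_ , _ , kept p₂ , kept q₂ , r₂) ,
          (_ , _ , kept' p₃ , kept' q₃ , r₃) , (_ , _ , kept' p₄ , kept' q₄ , r₄))
  cut-exchange (inj₂ ((_ , _ , p₁ , q₁ , r₁) , (_ , _ , p₂ , q₂ , r₂) , (_ , _ , p₃ , q₃ , r₃) , (_ , _ , p₄ , q₄ , r₄))) =
    inj₂ ((_ , _ , kept p₁ , kept q₁ , r₁) , (_ , _ , kept p₂ , kept q₂ , r₂) ,
          (_ , _ , kept' p₃ , kept' q₃ , r₃) , (_ , _ , kept' p₄ , kept' q₄ , r₄))
... | go s with together {u} V s
...   | both t t' = dual-cong (step-slide {f} t) (step-slide {f} t')
  (slide-dual f (step-valid V t) (step-valid V' t') (dual u ch refl (exchange-step V V' t t' ex)) (slide-fuel f t b))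
...   | apart⁻ eqR eqD with ch
...     | inj₂ refl = ⊥-elim (upper-not-apart⁻ V V' ex eqR eqD)
...     | inj₁ refl = rejoin-dual f V V' ex b eqR eqD
slide-dual (suc f) {p} {g} {r = r} {c} V V' (dual u ch refl ex) b | go s | apart eqR eqD with ch
... | inj₂ refl = ⊥-elim (upper-not-apart V V' ex eqR eqD)
-- With `p` on the right and `p + 1` below, it is the relabelled grid that has the configuration of
-- `Rejoin`; the roles are exchanged.
... | inj₁ refl = dual-sym (subst (λ h → Dual p (slide (suc f) r c g') (slide (suc f) r c h)) (mapGrid-involutive p g)
  (rejoin-dual f V' (subst (λ h → Valid (cell h) (At r c)) (sym back) V)
    (subst (Exchange p g') (sym back) (exchange-sym ex))
    (subst (_≤ suc f + (r + c)) (sym (cells-mapGrid (adj p) g)) b)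
    (trans (get-relabel {g = g} eqR) (cong just (adj-lower p)))
    (trans (get-relabel {g = g} eqD) (cong just (adj-upper p)))))
  where
  g' : Grid
  g' = mapGrid (adj p) g
  back : mapGrid (adj p) g' ≡ g
  back = mapGrid-involutive p g

-- After one step the hole is still a cell of the grid, so the fuel cannot be exhausted.
rejoin-dual zero V V' ex b eqR eqD = no-fuel (Rejoin.valid₁ V V' ex eqR eqD) (slide-fuel 0 (Rejoin.step₁ V V' ex eqR eqD) b)
rejoin-dual (suc f) V V' ex b eqR eqD =
  dual-cong (trans (step-slide {suc f} step₁) (step-slide {f} step₂))
            (trans (step-slide {suc f} step₁') (step-slide {f} step₂'))
    (slide-dual f (step-valid valid₁ step₂) (step-valid valid₁' step₂') meet (slide-fuel f step₂ (slide-fuel (suc f) step₁ b)))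
  where open Rejoin V V' ex eqR eqD

-- Rectification

leading-blank : ∀ xs {c} → c < leading xs → nth xs c ≡ blank
leading-blank (nothing ∷ xs) {zero}  lt       = refl
leading-blank (nothing ∷ xs) {suc c} (s≤s lt) = leading-blank xs lt

leading-end : ∀ xs → nth xs (leading xs) ≢ blank
leading-end []             ()
leading-end (nothing ∷ xs) eq = leading-end xs eq
leading-end (just _ ∷ xs)  ()

no-corner : ∀ g → findCorner g ≡ nothing → ∀ {a row} → nth g a ≡ just row → leading row ≡ 0
no-corner (x ∷ g) eq {a} p with findCorner g in eq'
... | nothing with leading x in lx
no-corner (x ∷ g) refl {zero}  refl | nothing | zero = lx
no-corner (x ∷ g) refl {suc a} p    | nothing | zero = no-corner g eq' p

corner-row : ∀ g {r c} → findCorner g ≡ just (r , c) → ∃ λ row → nth g r ≡ just row × leading row ≡ suc c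
corner-row (x ∷ g) eq with findCorner g in eq'
corner-row (x ∷ g) refl | just (r , c) = corner-row g eq'
... | nothing with leading x in lx
corner-row (x ∷ g) refl | nothing | suc c = x , refl , lx

corner-below : ∀ g {r c} → findCorner g ≡ just (r , c) → ∀ {a row} → r < a → nth g a ≡ just row → leading row ≡ 0
corner-below (x ∷ g) eq lt p with findCorner g in eq'
corner-below (x ∷ g) refl {suc a} (s≤s lt) p | just (r , c) = corner-below g eq' lt p
... | nothing with leading x
corner-below (x ∷ g) refl {suc a} lt p | nothing | suc c = no-corner g eq' p

-- The chosen cell ends the blanks of its row, and no lower row has any. No other blank cell
-- therefore lies weakly below and right of it, and declaring it the hole leaves the inner cells
-- closed.
corner-valid : ∀ {g r c} → Valid (cell g) Nowhere → findCorner g ≡ just (r , c) → Valid (cell g) (At r c)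
corner-valid {g} {r} {c} V eq = record
  { range    = range V
  ; inner    = inn
  ; hole     = λ { (refl , refl) → blank-to (≤-refl) }
  ; rowIncr  = rowIncr V
  ; colIncr  = colIncr V
  ; distinct = distinct V
  }
  where
  blank-to : ∀ {b} → b ≤ c → cell g r b ≡ blank
  blank-to le with corner-row g eq
  ... | row , p , l = row-cell p (leading-blank row (subst (_ <_) (sym l) (s≤s le)))
  last-blank : ∀ {a b} → cell g a b ≡ blank → r ≤ a → c ≤ b → At r c a b
  last-blank {a} {b} p r≤ c≤ with m≤n⇒m<n∨m≡n r≤ | m≤n⇒m<n∨m≡n c≤
  ... | inj₂ refl | inj₂ refl = refl , refl
  ... | inj₂ refl | inj₁ c< with corner-row g eq | cell-row (proj₁ (inner V p id ≤-refl c<))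
  ...   | row , q , l | row' , q' , e with refl ← trans (sym q) q' = ⊥-elim (leading-end row (trans (cong (nth row) l) e))
  last-blank {a} {b} p r≤ c≤ | inj₁ r< | _ with cell-row (proj₁ (inner V p id ≤-refl z≤n))
  ... | row , q , e = ⊥-elim (leading-end row (trans (cong (nth row) (corner-below g eq r< q)) e))
  inn : ∀ {a b a' b'} → cell g a b ≡ blank → ¬ At r c a b → a' ≤ a → b' ≤ b → cell g a' b' ≡ blank × ¬ At r c a' b'
  inn p ne a≤ b≤ = proj₁ (inner V p id a≤ b≤) , λ { (refl , refl) → ne (last-blank p a≤ b≤) }

rectify-done : ∀ f g → findCorner g ≡ nothing → rectify f g ≡ g
rectify-done zero    g eq = refl
rectify-done (suc f) g eq rewrite eq = refl

rectify-slide : ∀ f g {r c} → findCorner g ≡ just (r , c) →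
                rectify (suc f) g ≡ rectify f (slide (suc (cells g)) r c g)
rectify-slide f g eq rewrite eq = refl

rectify-fuel : ∀ g n → cells g ≤ suc (cells g) + n
rectify-fuel g n = ≤-trans (n≤1+n _) (m≤m+n _ _)

rectify-valid : ∀ f {g} → Valid (cell g) Nowhere → Valid (cell (rectify f g)) Nowhere
rectify-valid zero V = V
rectify-valid (suc f) {g} V with findCorner g in eq
... | nothing      = V
... | just (r , c) = rectify-valid f (slide-valid (suc (cells g)) (corner-valid V eq) (rectify-fuel g _))

-- Relabelling leaves the blank cells in place, so both rectifications choose the same corner with
-- the same fuel at every stage.
rectify-dual : ∀ f {p g g'} → Valid (cell g) Nowhere → Valid (cell g') Nowhere → Dual p g g' →
               Dual p (rectify f g) (rectify f g')
rectify-dual zero V V' D = D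
rectify-dual (suc f) {p} {g} V V' D@(dual u ch refl ex) = decide _ refl
  where
  g' : Grid
  g' = mapGrid (adj u) g
  decide : ∀ m → findCorner g ≡ m → Dual p (rectify (suc f) g) (rectify (suc f) g')
  decide nothing eq =
    dual-cong (rectify-done (suc f) g eq) (rectify-done (suc f) g' (trans (findCorner-mapGrid (adj u) g) eq)) D
  decide (just (r , c)) eq =
    dual-cong (rectify-slide f g eq)
      (trans (rectify-slide f g' eq') (cong (λ n → rectify f (slide (suc n) r c g')) (cells-mapGrid (adj u) g)))
      (rectify-dual f
        (slide-valid (suc (cells g)) (corner-valid V eq) (rectify-fuel g _))
        (slide-valid (suc (cells g)) (corner-valid V' eq')
          (subst (_≤ suc (cells g) + (r + c)) (sym (cells-mapGrid (adj u) g)) (rectify-fuel g _)))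
        (slide-dual (suc (cells g)) (corner-valid V eq) (corner-valid V' eq') D (rectify-fuel g _)))
    where
    eq' : findCorner g' ≡ just (r , c)
    eq' = trans (findCorner-mapGrid (adj u) g) eq

-- Comparing rows in two tableaux

-- The local test of `rowOf`, made available for separate reasoning; `rowOf-∷` connects the two.
hasEntry : List (Maybe ℕ) → ℕ → Bool
hasEntry []             x = false
hasEntry (nothing ∷ ys) x = hasEntry ys x
hasEntry (just y ∷ ys)  x = (y ≡ᵇ x) ∨ hasEntry ys x

rowOf-∷ : ∀ row g x → rowOf (row ∷ g) x ≡ (if hasEntry row x then just zero else Maybe.map suc (rowOf g x))
rowOf-∷ []             g x = refl
rowOf-∷ (nothing ∷ ys) g x = rowOf-∷ ys g x
rowOf-∷ (just y ∷ ys)  g x with y ≡ᵇ x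
... | true  = refl
... | false = rowOf-∷ ys g x

hasEntry-adj : ∀ u row x → hasEntry (map (Maybe.map (adj u)) row) (adj u x) ≡ hasEntry row x
hasEntry-adj u []             x = refl
hasEntry-adj u (nothing ∷ ys) x = hasEntry-adj u ys x
hasEntry-adj u (just y ∷ ys)  x = cong₂ _∨_ (same-eq (y ≟ x)) (hasEntry-adj u ys x)
  where
  same-eq : Dec (y ≡ x) → (adj u y ≡ᵇ adj u x) ≡ (y ≡ᵇ x)
  same-eq (yes e) = trans (dec-true (adj u y ≟ adj u x) (cong (adj u) e)) (sym (dec-true (y ≟ x) e))
  same-eq (no ne) = trans (dec-false (adj u y ≟ adj u x) (ne ∘ adj-injective)) (sym (dec-false (y ≟ x) ne))

hasEntry-nth : ∀ row {x} → hasEntry row x ≡ true → ∃ λ c → nth row c ≡ entry x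
hasEntry-nth (nothing ∷ ys) p = let c , q = hasEntry-nth ys p in suc c , q
hasEntry-nth (just y ∷ ys) {x} p with y ≟ x
... | yes refl = zero , refl
... | no ne = let c , q = hasEntry-nth ys (trans (cong (_∨ hasEntry ys x) (sym (dec-false (y ≟ x) ne))) p) in suc c , q

nth-hasEntry : ∀ row {c x} → nth row c ≡ entry x → hasEntry row x ≡ true
nth-hasEntry (nothing ∷ ys) {suc c} p = nth-hasEntry ys p
nth-hasEntry (just y ∷ ys) {zero} {x} refl rewrite dec-true (x ≟ x) refl = refl
nth-hasEntry (just y ∷ ys) {suc c} {x} p rewrite nth-hasEntry ys p with y ≡ᵇ x
... | true  = refl
... | false = refl

opaque
  unfolding cell mapGrid

  rowOf-adj : ∀ u g x → rowOf (mapGrid (adj u) g) (adj u x) ≡ rowOf g x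
  rowOf-adj u []        x = refl
  rowOf-adj u (row ∷ g) x
    rewrite rowOf-∷ (map (Maybe.map (adj u)) row) (mapGrid (adj u) g) (adj u x) | rowOf-∷ row g x
          | hasEntry-adj u row x | rowOf-adj u g x = refl

  rowOf-only : ∀ g {r c x} → cell g r c ≡ entry x → (∀ r' c' → cell g r' c' ≡ entry x → r' ≡ r) → rowOf g x ≡ just r
  rowOf-only (row ∷ g) {r} {c} {x} p only rewrite rowOf-∷ row g x with hasEntry row x in eq
  ... | true = let c , q = hasEntry-nth row eq in cong just (only 0 c q)
  rowOf-only (row ∷ g) {zero}  p only | false with () ← trans (sym eq) (nth-hasEntry row p)
  rowOf-only (row ∷ g) {suc r} p only | false
    rewrite rowOf-only g p (λ r' c' q → suc-injective (only (suc r') c' q)) = refl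

rowOf-inRow : ∀ {g H r x} → Valid (cell g) H → InRow (cell g) r x → rowOf g x ≡ just r
rowOf-inRow {g} V (_ , p) = rowOf-only g p λ r' c' q → proj₁ (distinct V q p)

row-adj⁻ : ∀ {g a u z} → InRow (cell (mapGrid (adj u) g)) a z → InRow (cell g) a (adj u z)
row-adj⁻ {g} {a} {u} (c , p) with entry-mapGrid⁻ p
... | x , q , refl = c , subst (λ y → cell g a c ≡ entry y) (sym (adj-involutive u x)) q

Agree : (ℕ → Set) → Grid → Grid → Set
Agree B g h = ∀ x → B x → rowOf g x ≡ rowOf h x

module _ {p g h} (V : Valid (cell g) Nowhere) (W : Valid (cell h) Nowhere)
         (agree : Agree (λ x → x ≡ p ⊎ x ≡ suc p ⊎ x ≡ suc (suc p)) g h) where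

  private
    same-row : ∀ {a b} x → (x ≡ p ⊎ x ≡ suc p ⊎ x ≡ suc (suc p)) → InRow (cell g) a x → InRow (cell h) b x → a ≡ b
    same-row x x∈ i j = just-injective (trans (sym (rowOf-inRow V i)) (trans (agree x x∈) (rowOf-inRow W j)))

    low : ∀ {a} → InRow (cell (mapGrid (adj (suc p)) g)) a p → InRow (cell g) a p
    low i = subst (InRow (cell g) _) (adj-other (1+n≢n ∘ sym) (<⇒≢ (m<n+m p {2} (s≤s z≤n)))) (row-adj⁻ i)

    high : ∀ {a} → InRow (cell (mapGrid (adj (suc p)) g)) a (suc p) → InRow (cell g) a (suc (suc p))
    high i = subst (InRow (cell g) _) (adj-lower (suc p)) (row-adj⁻ i)

    low' : ∀ {a} → InRow (cell (mapGrid (adj p) h)) a (suc p) → InRow (cell h) a p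
    low' i = subst (InRow (cell h) _) (adj-upper p) (row-adj⁻ i)

    high' : ∀ {a} → InRow (cell (mapGrid (adj p) h)) a (suc (suc p)) → InRow (cell h) a (suc (suc p))
    high' i = subst (InRow (cell h) _) (adj-other (λ ()) 1+n≢n) (row-adj⁻ i)

  -- If both exchanges are of the same kind, the rows of the old `p` and `p + 2` become those of
  -- `p`, `p + 1` in one grid and of `p + 1`, `p + 2` in the other, where one exchange requires an
  -- ascent and the other a descent. If the kinds differ, `p` itself is a descent in only one grid.
  exchanges-differ : Exchange p g (mapGrid (adj (suc p)) g) → Exchange p h (mapGrid (adj p) h) → ⊥
  exchanges-differ (inj₁ (_ , _ , (_ , _ , i , j , le) , _)) (inj₁ (_ , _ , _ , (_ , _ , i' , j' , lt)))
    with refl ← same-row _ (inj₁ refl) (low i) (low' i')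
       | refl ← same-row _ (inj₂ (inj₂ refl)) (high j) (high' j') = <⇒≱ lt le
  exchanges-differ (inj₂ (_ , _ , (_ , _ , i , j , lt) , _)) (inj₂ (_ , _ , _ , (_ , _ , i' , j' , le)))
    with refl ← same-row _ (inj₁ refl) (low i) (low' i')
       | refl ← same-row _ (inj₂ (inj₂ refl)) (high j) (high' j') = <⇒≱ lt le
  exchanges-differ (inj₁ ((_ , _ , i , j , lt) , _)) (inj₂ ((_ , _ , i' , j' , le) , _))
    with refl ← same-row _ (inj₁ refl) i i' | refl ← same-row _ (inj₂ (inj₁ refl)) j j' = <⇒≱ lt le
  exchanges-differ (inj₂ ((_ , _ , i , j , le) , _)) (inj₁ ((_ , _ , i' , j' , lt) , _))
    with refl ← same-row _ (inj₁ refl) i i' | refl ← same-row _ (inj₂ (inj₁ refl)) j j' = <⇒≱ lt le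

rowOf-relabelled : ∀ u g x → rowOf (mapGrid (adj u) g) x ≡ rowOf g (adj u x)
rowOf-relabelled u g x = trans (cong (rowOf (mapGrid (adj u) g)) (sym (adj-involutive u x))) (rowOf-adj u g (adj u x))

agree-inside : ∀ {p B g g' h h'} → Valid (cell g) Nowhere → Valid (cell h) Nowhere →
               B p → B (suc p) → B (suc (suc p)) → Dual p g g' → Dual p h h' → Agree B g h → Agree B g' h'
agree-inside {p} {B} {g} {h = h} V W b₀ b₁ b₂ (dual u ch refl ex) (dual u' ch' refl ex') A = transfer ch ch'
  where
  triple : Agree (λ x → x ≡ p ⊎ x ≡ suc p ⊎ x ≡ suc (suc p)) g h
  triple x (inj₁ refl)        = A x b₀
  triple x (inj₂ (inj₁ refl)) = A x b₁
  triple x (inj₂ (inj₂ refl)) = A x b₂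
  common : ∀ v → B v → B (suc v) → Agree B (mapGrid (adj v) g) (mapGrid (adj v) h)
  common v bv bsv x bx =
    trans (rowOf-relabelled v g x) (trans (A (adj v x) (moved (adjView v x))) (sym (rowOf-relabelled v h x)))
    where
    moved : AdjView v x → B (adj v x)
    moved lower       = subst B (sym (adj-lower v)) bsv
    moved upper       = subst B (sym (adj-upper v)) bv
    moved (other q r) = subst B (sym (adj-other q r)) bx
  transfer : u ≡ p ⊎ u ≡ suc p → u' ≡ p ⊎ u' ≡ suc p → Agree B (mapGrid (adj u) g) (mapGrid (adj u') h)
  transfer (inj₁ refl) (inj₁ refl) = common p b₀ b₁
  transfer (inj₂ refl) (inj₂ refl) = common (suc p) b₁ b₂
  transfer (inj₂ refl) (inj₁ refl) = ⊥-elim (exchanges-differ V W triple ex ex')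
  transfer (inj₁ refl) (inj₂ refl) = ⊥-elim (exchanges-differ W V (λ x x∈ → sym (triple x x∈)) ex' ex)

agree-outside : ∀ {p B g g' h h'} → (∀ {x} → B x → suc (suc p) < x) → Dual p g g' → Dual p h h' → Agree B g h → Agree B g' h'
agree-outside {p} {B} {g} {h = h} beyond (dual u ch refl _) (dual u' ch' refl _) A x bx =
  trans (rowOf-relabelled u g x) (trans (cong (rowOf g) (fixed ch)) (trans (A x bx)
    (sym (trans (rowOf-relabelled u' h x) (cong (rowOf h) (fixed ch'))))))
  where
  fixed : ∀ {v} → v ≡ p ⊎ v ≡ suc p → adj v x ≡ x
  fixed (inj₁ refl) = adj-other (λ { refl → <⇒≱ (beyond bx) (≤-trans (n≤1+n _) (n≤1+n _)) }) (λ { refl → <⇒≱ (beyond bx) (n≤1+n _) })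
  fixed (inj₂ refl) = adj-other (λ { refl → <⇒≱ (beyond bx) (n≤1+n _) }) (λ { refl → <-irrefl refl (beyond bx) })

-- By `adj-<` the order can break only between `u` and `u + 1` in a common row or column, and the
-- exchange excludes both.
dual-valid : ∀ {p g g'} → Valid (cell g) Nowhere → Dual p g g' → Valid (cell g') Nowhere
dual-valid {p} {g} V (dual u ch refl ex) = record
  { range    = λ q r≤ c≤ → let _ , q' = just-mapGrid⁻ {adj u} q ; _ , e = range V q' r≤ c≤ in _ , just-mapGrid e
  ; inner    = λ q _ r≤ c≤ → just-mapGrid (proj₁ (inner V (blank-mapGrid⁻ q) id r≤ c≤)) , λ ()
  ; hole     = λ ()
  ; rowIncr  = rows
  ; colIncr  = cols
  ; distinct = dist
  }
  where
  g' : Grid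
  g' = mapGrid (adj u) g
  D-transfer : ∀ {a b x} → InRow (cell g) a x → InRow (cell g) b (suc x) → a < b → ¬ Ascent (cell g) x
  D-transfer i j lt as = ascent-descent V as (_ , _ , i , j , lt)
  A-transfer : ∀ {a b x} → InRow (cell g) a x → InRow (cell g) b (suc x) → b ≤ a → ¬ Descent (cell g) x
  A-transfer i j le ds = ascent-descent V (_ , _ , i , j , le) ds
  dist : ∀ {r c r' c' x} → cell g' r c ≡ entry x → cell g' r' c' ≡ entry x → r ≡ r' × c ≡ c'
  dist q q' with entry-mapGrid⁻ q | entry-mapGrid⁻ q'
  ... | y , e , refl | y' , e' , eq with refl ← adj-injective eq = distinct V e e'

  low : ∀ {a} → u ≡ suc p → InRow (cell g') a p → InRow (cell g) a p
  low refl i = subst (InRow (cell g) _) (adj-other (1+n≢n ∘ sym) (<⇒≢ (m<n+m p {2} (s≤s z≤n)))) (row-adj⁻ i)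
  mid : ∀ {a} → u ≡ suc p → InRow (cell g') a (suc p) → InRow (cell g) a (suc (suc p))
  mid refl i = subst (InRow (cell g) _) (adj-lower (suc p)) (row-adj⁻ i)
  mid' : ∀ {a} → u ≡ p → InRow (cell g') a (suc p) → InRow (cell g) a p
  mid' refl i = subst (InRow (cell g) _) (adj-upper p) (row-adj⁻ i)
  high : ∀ {a} → u ≡ p → InRow (cell g') a (suc (suc p)) → InRow (cell g) a (suc (suc p))
  high refl i = subst (InRow (cell g) _) (adj-other (λ ()) 1+n≢n) (row-adj⁻ i)

  -- Interchanging two entries of one row changes the row of no entry, hence no descent.
  not-in-row : ∀ {r c c'} → u ≡ p ⊎ u ≡ suc p → Exchange p g g' → cell g r c ≡ entry u → cell g r c' ≡ entry (suc u) → ⊥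
  not-in-row (inj₁ refl) (inj₁ (ds , _)) q q' = A-transfer (_ , q) (_ , q') ≤-refl ds
  not-in-row (inj₁ refl) (inj₂ (_ , (_ , _ , i , j , lt) , _ , (_ , _ , i' , j' , le))) q q'
    with refl ← row-unique V (mid' refl i') (_ , q) | refl ← row-unique V i (_ , q') | refl ← row-unique V j (high refl j') = <⇒≱ lt le
  not-in-row (inj₂ refl) (inj₂ (_ , ds , _)) q q' = A-transfer (_ , q) (_ , q') ≤-refl ds
  not-in-row (inj₂ refl) (inj₁ ((_ , _ , i , j , lt) , _ , (_ , _ , i' , j' , le) , _)) q q'
    with refl ← row-unique V j (_ , q) | refl ← row-unique V (mid refl j') (_ , q') | refl ← row-unique V i (low refl i') = <⇒≱ lt le

  -- The nontrivial cases place the third entry in a row between those of `u` and `u + 1`. On one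
  -- side of the column this contradicts `mono`; on the other side a corner cell lies between `p`
  -- and `p + 2` and would hold a second `p + 1`.
  not-in-col : ∀ {r r' c} → u ≡ p ⊎ u ≡ suc p → Exchange p g g' → r < r' → cell g r c ≡ entry u → cell g r' c ≡ entry (suc u) → ⊥
  not-in-col (inj₁ refl) (inj₂ (as , _)) lt q q' = D-transfer (_ , q) (_ , q') lt as
  not-in-col {c = c} (inj₁ refl) (inj₁ (_ , (_ , _ , i , j@(b , e) , le) , _ , (_ , _ , i' , j' , lt))) _ q q'
    with refl ← row-unique V (mid' refl i') (_ , q) | refl ← row-unique V i (_ , q') | refl ← row-unique V (high refl j') j
    with b ≤? c
  ... | yes b≤ = <⇒≱ (n<1+n _) (mono V e q' le b≤)
  ... | no b≰ with range V e (<⇒≤ lt) ≤-refl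
  ...   | _ , f with filled V f id ≤-refl (<⇒≤ (≰⇒> b≰)) (inj₂ (_ , q))
  ...     | z , f' with refl ← ≤-antisym (rowIncr V q f' (≰⇒> b≰)) (≤-pred (colIncr V f' e lt)) =
    b≰ (≤-reflexive (proj₂ (distinct V f' q')))
  not-in-col (inj₂ refl) (inj₁ (_ , as , _)) lt q q' = D-transfer (_ , q) (_ , q') lt as
  not-in-col {c = c} (inj₂ refl) (inj₂ ((_ , _ , i@(b , e) , j , le) , _ , (_ , _ , i' , j' , lt) , _)) _ q q'
    with refl ← row-unique V j (_ , q) | refl ← row-unique V (mid refl j') (_ , q') | refl ← row-unique V (low refl i') i
    with c ≤? b
  ... | yes c≤ = <⇒≱ (n<1+n _) (mono V q e le c≤)
  ... | no c≰ with range V q' ≤-refl (<⇒≤ (≰⇒> c≰))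
  ...   | _ , f with filled V f id (<⇒≤ lt) ≤-refl (inj₂ (_ , e))
  ...     | z , f' with refl ← ≤-antisym (colIncr V e f' lt) (≤-pred (rowIncr V f' q' (≰⇒> c≰))) =
    c≰ (≤-reflexive (sym (proj₂ (distinct V f' q))))

  rows : ∀ {r c c' x y} → cell g' r c ≡ entry x → cell g' r c' ≡ entry y → c < c' → x < y
  rows q q' lt with entry-mapGrid⁻ q | entry-mapGrid⁻ q'
  ... | x , e , refl | y , e' , refl with adj-< {u} (rowIncr V e e' lt)
  ...   | inj₁ lt' = lt'
  ...   | inj₂ (refl , refl) = ⊥-elim (not-in-row ch ex e e')
  cols : ∀ {r r' c x y} → cell g' r c ≡ entry x → cell g' r' c ≡ entry y → r < r' → x < y
  cols q q' lt with entry-mapGrid⁻ q | entry-mapGrid⁻ q'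
  ... | x , e , refl | y , e' , refl with adj-< {u} (colIncr V e e' lt)
  ...   | inj₁ lt' = lt'
  ...   | inj₂ (refl , refl) = ⊥-elim (not-in-col ch ex lt e e')

-- Skew tableaux as grids

Entry : SkewTab → ℕ → ℕ → ℕ → ℕ → Set
Entry S r a i x = ∃ λ u → nth S r ≡ just (a , u) × nth u i ≡ just x

nth-replicate-< : ∀ {A : Set} {x : A} {n c} ys → c < n → nth (replicate n x ++ ys) c ≡ just x
nth-replicate-< {n = suc n} {zero}  ys lt       = refl
nth-replicate-< {n = suc n} {suc c} ys (s≤s lt) = nth-replicate-< ys lt

nth-replicate-+ : ∀ {A : Set} {x : A} n {i} ys → nth (replicate n x ++ ys) (n + i) ≡ nth ys i
nth-replicate-+ zero    ys = refl
nth-replicate-+ (suc n) ys = nth-replicate-+ n ys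

nth-just⁻ : ∀ {A : Set} (xs : List A) {n y} → nth (map just xs) n ≡ just y → ∃ λ x → nth xs n ≡ just x × y ≡ just x
nth-just⁻ xs {n} eq with nth xs n | trans (sym (nth-map just xs n)) eq
... | just x | refl = x , refl , refl

data CellView (S : SkewTab) (r c : ℕ) : Maybe ℕ → Set where
  innerCell : ∀ {a u} → nth S r ≡ just (a , u) → c < a → CellView S r c nothing
  entryCell : ∀ {a i x} → Entry S r a i x → c ≡ a + i → CellView S r c (just x)

toGrid-row : ∀ {S r a u} → nth S r ≡ just (a , u) → nth (toGrid S) r ≡ just (replicate a nothing ++ map just u)
toGrid-row {S} {r} eq = trans (nth-map _ S r) (cong (Maybe.map _) eq)

cell-inner : ∀ {S r c a u} → nth S r ≡ just (a , u) → c < a → cell (toGrid S) r c ≡ blank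
cell-inner {S} eq lt = row-cell (toGrid-row {S} eq) (nth-replicate-< _ lt)

cell-entry : ∀ {S r a i x} → Entry S r a i x → cell (toGrid S) r (a + i) ≡ entry x
cell-entry {S} {a = a} {i} (u , eq , p) =
  row-cell (toGrid-row {S} eq) (trans (nth-replicate-+ a (map just u)) (trans (nth-map just u i) (cong (Maybe.map just) p)))

cell-view : ∀ S {r c v} → cell (toGrid S) r c ≡ just v → CellView S r c v
cell-view S {r} {c} eq with cell-row {toGrid S} eq
... | row , p , q with nth S r in e | trans (sym (nth-map _ S r)) p
...   | just (a , u) | refl with c <? a
...     | yes lt with refl ← trans (sym q) (nth-replicate-< (map just u) lt) = innerCell e lt
...     | no nlt with nth-just⁻ u (trans (sym (trans (cong (nth (replicate a nothing ++ map just u)) (sym (m+[n∸m]≡n (≮⇒≥ nlt))))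
                                                     (nth-replicate-+ a (map just u)))) q)
...       | x , q' , refl = entryCell (u , e , q') (sym (m+[n∸m]≡n (≮⇒≥ nlt)))

cell-toGrid⁻ : ∀ S {r c x} → cell (toGrid S) r c ≡ entry x → ∃₂ λ a i → Entry S r a i x × c ≡ a + i
cell-toGrid⁻ S eq with cell-view S eq
... | entryCell e c≡ = _ , _ , e , c≡

SkewShape : SkewTab → Set
SkewShape S = ∀ {r r' a u b v} → r ≤ r' → nth S r ≡ just (a , u) → nth S r' ≡ just (b , v) →
              b ≤ a × b + length v ≤ a + length u

toGrid-defined : ∀ S {r c a u} → nth S r ≡ just (a , u) → c < a + length u → ∃ λ v → cell (toGrid S) r c ≡ just v
toGrid-defined S {r} {c} {a} {u} eq lt with c <? a
... | yes c<a = _ , cell-inner {S} eq c<a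
... | no c≮a with nth-defined u (+-cancelˡ-< a (c ∸ a) (length u) (subst (_< a + length u) (sym (m+[n∸m]≡n (≮⇒≥ c≮a))) lt))
...   | x , p = just x , subst (λ b → cell (toGrid S) r b ≡ entry x) (m+[n∸m]≡n (≮⇒≥ c≮a)) (cell-entry (u , eq , p))

toGrid-valid : ∀ {S} → SkewShape S →
  (∀ {r a i i' x y} → Entry S r a i x → Entry S r a i' y → i < i' → x < y) →
  (∀ {r r' a b i i' x y} → Entry S r a i x → Entry S r' b i' y → r < r' → a + i ≡ b + i' → x < y) →
  (∀ {r r' a b i i' x} → Entry S r a i x → Entry S r' b i' x → r ≡ r' × a + i ≡ b + i') →
  Valid (cell (toGrid S)) Nowhere
toGrid-valid {S} shape rows cols dist = record
  { range    = rng
  ; inner    = inn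
  ; hole     = λ ()
  ; rowIncr  = row-incr
  ; colIncr  = col-incr
  ; distinct = dst
  }
  where
  view-bound : ∀ {r c v} → CellView S r c v → ∃₂ λ a u → nth S r ≡ just (a , u) × c < a + length u
  view-bound (innerCell eq lt) = _ , _ , eq , ≤-trans lt (m≤m+n _ _)
  view-bound (entryCell {a} (u , eq , p) refl) = a , u , eq , +-monoʳ-< a (nth-< u p)
  rng : ∀ {r c r' c' v} → cell (toGrid S) r c ≡ just v → r' ≤ r → c' ≤ c → ∃ λ v' → cell (toGrid S) r' c' ≡ just v'
  rng p r≤ c≤ with view-bound (cell-view S p)
  ... | a , u , eq , lt with nth-defined S (≤-<-trans r≤ (nth-< S eq))
  ...   | (b , v) , eq' = toGrid-defined S eq' (≤-<-trans c≤ (<-≤-trans lt (proj₂ (shape r≤ eq' eq))))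
  inn : ∀ {r c r' c'} → cell (toGrid S) r c ≡ blank → ¬ Nowhere r c → r' ≤ r → c' ≤ c →
        cell (toGrid S) r' c' ≡ blank × ¬ Nowhere r' c'
  inn p _ r≤ c≤ with cell-view S p
  ... | innerCell eq lt with nth-defined S (≤-<-trans r≤ (nth-< S eq))
  ...   | (b , v) , eq' = cell-inner {S} eq' (≤-<-trans c≤ (<-≤-trans lt (proj₁ (shape r≤ eq' eq)))) , λ ()
  row-incr : ∀ {r c c' x y} → cell (toGrid S) r c ≡ entry x → cell (toGrid S) r c' ≡ entry y → c < c' → x < y
  row-incr p q lt with cell-view S p | cell-view S q
  ... | entryCell {a} e@(_ , eq , _) refl | entryCell e'@(_ , eq' , _) refl
    with refl ← trans (sym eq) eq' = rows e e' (+-cancelˡ-< a _ _ lt)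
  col-incr : ∀ {r r' c x y} → cell (toGrid S) r c ≡ entry x → cell (toGrid S) r' c ≡ entry y → r < r' → x < y
  col-incr p q lt with cell-view S p | cell-view S q
  ... | entryCell e c≡ | entryCell e' c≡' = cols e e' lt (trans (sym c≡) c≡')
  dst : ∀ {r c r' c' x} → cell (toGrid S) r c ≡ entry x → cell (toGrid S) r' c' ≡ entry x → r ≡ r' × c ≡ c'
  dst p q with cell-view S p | cell-view S q
  ... | entryCell e c≡ | entryCell e' c≡' =
    map₂ (λ c → trans c≡ (trans c (sym c≡'))) (dist e e')

-- Standard skew tableaux

-- The consequences of standardness that are carried along a sequence of moves; `relabel-good`
-- restores each of them after a move.
record Good (S : SkewTab) : Set where
  field
    shape    : SkewShape S
    lengths  : ∀ {r r' a u b v} → r ≤ r' → nth S r ≡ just (a , u) → nth S r' ≡ just (b , v) → length v ≤ length u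
    valid    : Valid (cell (toGrid S)) Nowhere
    positive : ∀ {r a i x} → Entry S r a i x → 1 ≤ x
    bounded  : ∀ {r a i x} → Entry S r a i x → x ≤ size S

  entry-unique : ∀ {r r' a b i i' x} → Entry S r a i x → Entry S r' b i' x → r ≡ r' × a + i ≡ b + i'
  entry-unique e e' = distinct valid (cell-entry e) (cell-entry e')

  row-positive : ∀ {r x} → InRow (cell (toGrid S)) r x → 1 ≤ x
  row-positive (_ , p) with cell-toGrid⁻ S p
  ... | _ , _ , e , _ = positive e

  row-bounded : ∀ {r x} → InRow (cell (toGrid S)) r x → x ≤ size S
  row-bounded (_ , p) with cell-toGrid⁻ S p
  ... | _ , _ , e , _ = bounded e

antitone-rows : ∀ {A : Set} (xs : List A) (_≽_ : A → A → Set) → (∀ {x} → x ≽ x) → (∀ {x y z} → x ≽ y → y ≽ z → x ≽ z) →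
                (∀ r {x y} → nth xs r ≡ just x → nth xs (suc r) ≡ just y → x ≽ y) →
                ∀ {r r' x y} → r ≤ r' → nth xs r ≡ just x → nth xs r' ≡ just y → x ≽ y
antitone-rows xs _≽_ rfl tr adj≽ {r} {r'} r≤ p q with m≤n⇒m<n∨m≡n r≤
... | inj₂ refl = subst (_ ≽_) (just-injective (trans (sym p) q)) rfl
antitone-rows xs _≽_ rfl tr adj≽ {r} {suc r'} r≤ p q | inj₁ (s≤s r≤')
  with nth-defined xs (<-trans (n<1+n r') (nth-< xs q))
... | z , e = tr (antitone-rows xs _≽_ rfl tr adj≽ r≤' p e) (adj≽ r' e q)

-- The second condition excludes gaps after `m`, so that the adjacent comparisons form an unbroken
-- chain. It serves rows and columns alike.
increasing : ∀ (f : ℕ → Maybe ℕ) {m} → (∀ n x y → f n ≡ just x → f (suc n) ≡ just y → x < y) →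
             (∀ n {y} → m ≤ n → f (suc n) ≡ just y → ∃ λ x → f n ≡ just x) →
             ∀ {n x y} → f m ≡ just x → f n ≡ just y → m < n → x < y
increasing f adj< conn {suc n} p q (s≤s le) with m≤n⇒m<n∨m≡n le
... | inj₂ refl = adj< _ _ _ p q
... | inj₁ lt with conn n le q
...   | z , e = <-trans (increasing f adj< conn p e lt) (adj< _ _ _ e q)

entryAt-entry : ∀ {S r a i x} → Entry S r a i x → entryAt S r (a + i) ≡ just x
entryAt-entry {a = a} {i} (u , eq , p)
  rewrite eq | dec-false (a + i <? a) (≤⇒≯ (m≤m+n a i)) | m+n∸m≡n a i = p

entryAt-entry⁻ : ∀ {S r c x} → entryAt S r c ≡ just x → ∃₂ λ a i → Entry S r a i x × c ≡ a + i
entryAt-entry⁻ {S} {r} {c} eq with nth S r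
... | just (a , w) with c <ᵇ a in lt
...   | false = a , c ∸ a , (w , refl , eq) , sym (m+[n∸m]≡n (≮⇒≥ λ c<a → case trans (sym lt) (dec-true (c <? a) c<a) of λ ()))

readingWord-∷ : ∀ p S → readingWord (p ∷ S) ≡ readingWord S ++ proj₂ p
readingWord-∷ p S =
  trans (cong concat (unfold-reverse (proj₂ p) (map proj₂ S)))
        (trans (sym (concat-++ (reverse (map proj₂ S)) (proj₂ p ∷ []))) (cong (readingWord S ++_) (++-identityʳ _)))

nth-∈ : ∀ {A : Set} (xs : List A) {n x} → nth xs n ≡ just x → x ∈ xs
nth-∈ (x ∷ xs) {zero}  refl = here refl
nth-∈ (x ∷ xs) {suc n} p    = there (nth-∈ xs p)

entry-∈ : ∀ S {r a i x} → Entry S r a i x → x ∈ readingWord S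
entry-∈ (p ∷ S) {zero}  (u , refl , q) rewrite readingWord-∷ p S = ∈-++⁺ʳ (readingWord S) (nth-∈ u q)
entry-∈ (p ∷ S) {suc r} (u , e , q) rewrite readingWord-∷ p S = ∈-++⁺ˡ (entry-∈ S (u , e , q))

unique-++ : ∀ {A : Set} (xs : List A) {ys} → Unique (xs ++ ys) →
            Unique xs × Unique ys × (∀ {x} → x ∈ xs → x ∈ ys → ⊥)
unique-++ []       U = [] , U , λ ()
unique-++ (x ∷ xs) (p ∷ U) with unique-++ xs U
... | Uxs , Uys , dis = ++⁻ˡ xs p ∷ Uxs , Uys ,
  λ { (here refl) y∈ → lookup (++⁻ʳ xs p) y∈ refl ; (there x∈) y∈ → dis x∈ y∈ }

unique-nth : ∀ {A : Set} (xs : List A) {i j x} → Unique xs → nth xs i ≡ just x → nth xs j ≡ just x → i ≡ j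
unique-nth (x ∷ xs) {zero}  {zero}  U       p    q    = refl
unique-nth (x ∷ xs) {zero}  {suc j} (a ∷ U) refl q    = contradiction refl (lookup a (nth-∈ xs q))
unique-nth (x ∷ xs) {suc i} {zero}  (a ∷ U) p    refl = contradiction refl (lookup a (nth-∈ xs p))
unique-nth (x ∷ xs) {suc i} {suc j} (a ∷ U) p    q    = cong suc (unique-nth xs U p q)

unique-entry : ∀ S {r r' a b i i' x} → Unique (readingWord S) → Entry S r a i x → Entry S r' b i' x →
               r ≡ r' × a + i ≡ b + i'
unique-entry (p ∷ S) {r} {r'} U e e' with unique-++ (readingWord S) (subst Unique (readingWord-∷ p S) U)
unique-entry (p ∷ S) {zero}  {zero}   U (u , refl , q) (_ , refl , q') | _ , Uu , _ = refl , cong (_ +_) (unique-nth u Uu q q')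
unique-entry (p ∷ S) {zero}  {suc r'} U (u , refl , q) (v , f , q')    | _ , _ , dis = ⊥-elim (dis (entry-∈ S (v , f , q')) (nth-∈ u q))
unique-entry (p ∷ S) {suc r} {zero}   U (u , f , q) (v , refl , q')    | _ , _ , dis = ⊥-elim (dis (entry-∈ S (u , f , q)) (nth-∈ v q'))
unique-entry (p ∷ S) {suc r} {suc r'} U (u , f , q) (v , f' , q')      | US , _ , _ =
  let r≡ , c≡ = unique-entry S US (u , f , q) (v , f' , q') in cong suc r≡ , c≡

standard-good : ∀ {S} → IsStandardSkew S → RowSizesDecreasing S → Good S
standard-good {S} std dec = record
  { shape    = shape
  ; lengths  = λ r≤ p q → antitone-rows S (λ x y → length (proj₂ y) ≤ length (proj₂ x)) ≤-refl (flip ≤-trans)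
                 (λ r p q → dec r _ _ _ _ p q) r≤ p q
  ; valid    = toGrid-valid {S} shape rows cols (unique-entry S unique)
  ; positive = λ e → let _ , _ , x≡ = ∈-map⁻ suc (member e) in subst (1 ≤_) (sym x≡) (s≤s z≤n)
  ; bounded  = λ e → let _ , y∈ , x≡ = ∈-map⁻ suc (member e) in subst (_≤ size S) (sym x≡) (∈-upTo⁻ y∈)
  }
  where
  open IsStandardSkew std
  shape : SkewShape S
  shape = antitone-rows S (λ x y → proj₁ y ≤ proj₁ x × proj₁ y + length (proj₂ y) ≤ proj₁ x + length (proj₂ x))
    (≤-refl , ≤-refl) (λ (p , q) (p' , q') → ≤-trans p' p , ≤-trans q' q)
    (λ r p q → skewShape r _ _ _ _ p q)
  member : ∀ {r a i x} → Entry S r a i x → x ∈ map suc (upTo (size S))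
  member e = ∈-resp-↭ entries (entry-∈ S e)
  unique : Unique (readingWord S)
  unique = Unique-resp-↭ (↭⇒↭ₛ (↭-sym entries)) (map⁺ suc-injective (upTo⁺ (size S)))
  rows : ∀ {r a i i' x y} → Entry S r a i x → Entry S r a i' y → i < i' → x < y
  rows {r} {a} e@(u , eq , p) e'@(v , eq' , q) lt with refl ← trans (sym eq) eq' =
    increasing (nth u)
      (λ n x y p q → rowsIncr r (a + n) x y (entryAt-entry {S} (u , eq , p))
        (subst (λ c → entryAt S r c ≡ just y) (+-suc a n) (entryAt-entry {S} (u , eq , q))))
      (λ n _ q → nth-defined u (<-trans (n<1+n n) (nth-< u q))) p q lt
  cols : ∀ {r r' a b i i' x y} → Entry S r a i x → Entry S r' b i' y → r < r' → a + i ≡ b + i' → x < y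
  cols {r} {r'} {a} {b} {i} {i'} e@(u , eq , p) e' lt c≡ =
    increasing (λ n → entryAt S n (a + i)) (λ n x y → colsIncr n (a + i) x y) connected
      (entryAt-entry {S} e) (trans (cong (entryAt S r') c≡) (entryAt-entry {S} e')) lt
    where
    -- Row `n` starts no later than row `r` and ends no earlier than row `n + 1`, so it has a cell
    -- in this column.
    connected : ∀ n {y} → r ≤ n → entryAt S (suc n) (a + i) ≡ just y → ∃ λ x → entryAt S n (a + i) ≡ just x
    connected n r≤ q with entryAt-entry⁻ {S} q
    ... | a' , i″ , (v , eq' , q') , c≡' with nth-defined S (<-trans (n<1+n n) (nth-< S eq'))
    ...   | (b' , w) , eq″ with shape r≤ eq eq″ | shape (n≤1+n n) eq″ eq'
    ...     | b'≤ , _ | _ , ends≤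
      with nth-defined w {a + i ∸ b'} (+-cancelˡ-< b' _ _ (subst (_< b' + length w)
             (sym (m+[n∸m]≡n (≤-trans b'≤ (m≤m+n a i))))
             (<-≤-trans (subst (_< a' + length v) (sym c≡') (+-monoʳ-< a' (nth-< v q'))) ends≤)))
    ...       | x , q″ = x , subst (λ c → entryAt S n c ≡ just x) (m+[n∸m]≡n (≤-trans b'≤ (m≤m+n a i)))
                               (entryAt-entry {S} (w , eq″ , q″))

-- Powers

-- One row of `power`, with the shift `m` detached from the tableau so that the size of a relabelled
-- tableau can be substituted.
rowPower : ℕ → List ℕ → ℕ → List ℕ
rowPower m u k = concatMap (λ j → shiftRow (j * m) u) (upTo k)

rowPower-suc : ∀ m u k → rowPower m u (suc k) ≡ rowPower m u k ++ shiftRow (k * m) u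
rowPower-suc m u k =
  trans (cong (concatMap (λ j → shiftRow (j * m) u)) (sym (upTo-∷ʳ k)))
        (trans (concatMap-++ (λ j → shiftRow (j * m) u) (upTo k) (k ∷ []))
               (cong (rowPower m u k ++_) (++-identityʳ _)))

length-rowPower : ∀ m u k → length (rowPower m u k) ≡ k * length u
length-rowPower m u zero = refl
length-rowPower m u (suc k) = trans (cong length (rowPower-suc m u k))
  (trans (length-++ (rowPower m u k))
         (trans (cong₂ _+_ (length-rowPower m u k) (length-map _ u)) (+-comm (k * length u) (length u))))

nth-++-< : ∀ {A : Set} (xs ys : List A) {n} → n < length xs → nth (xs ++ ys) n ≡ nth xs n
nth-++-< (x ∷ xs) ys {zero}  lt       = refl
nth-++-< (x ∷ xs) ys {suc n} (s≤s lt) = nth-++-< xs ys lt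

nth-++-+ : ∀ {A : Set} (xs ys : List A) n → nth (xs ++ ys) (length xs + n) ≡ nth ys n
nth-++-+ []       ys n = refl
nth-++-+ (x ∷ xs) ys n = nth-++-+ xs ys n

nth-rowPower : ∀ m u k {j i y} → j < k → nth u i ≡ just y → nth (rowPower m u k) (j * length u + i) ≡ just (y + j * m)
nth-rowPower m u (suc k) {j} {i} {y} j< p rewrite rowPower-suc m u k with m≤n⇒m<n∨m≡n (≤-pred j<)
... | inj₁ lt = trans (nth-++-< (rowPower m u k) _ {j * length u + i} (nth-< (rowPower m u k) (nth-rowPower m u k lt p)))
                      (nth-rowPower m u k lt p)
... | inj₂ refl = trans (cong (λ n → nth (rowPower m u k ++ shiftRow (k * m) u) (n + i)) (sym (length-rowPower m u k)))
                   (trans (nth-++-+ (rowPower m u k) _ i)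
                     (trans (nth-map (λ z → z + k * m) u i) (cong (Maybe.map (λ z → z + k * m)) p)))

nth-rowPower⁻ : ∀ m u k {n x} → nth (rowPower m u k) n ≡ just x →
                ∃ λ j → ∃₂ λ i y → j < k × n ≡ j * length u + i × nth u i ≡ just y × x ≡ y + j * m
nth-rowPower⁻ m u (suc k) {n} p rewrite rowPower-suc m u k with n <? length (rowPower m u k)
... | yes lt = let j , i , y , j< , rest = nth-rowPower⁻ m u k (trans (sym (nth-++-< (rowPower m u k) _ lt)) p)
               in j , i , y , <-trans j< (n<1+n k) , rest
... | no nlt with n ∸ length (rowPower m u k) | m+[n∸m]≡n (≮⇒≥ nlt)
...   | i | refl with nth u i in q | trans (sym (nth-map (λ z → z + k * m) u i)) (trans (sym (nth-++-+ (rowPower m u k) _ i)) p)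
...     | just y | refl = k , i , y , n<1+n k , cong (_+ i) (length-rowPower m u k) , q , refl

power-row : ∀ S k {r a u} → nth S r ≡ just (a , u) → nth (power S k) r ≡ just (a , rowPower (size S) u k)
power-row S k {r} eq = trans (nth-map _ S r) (cong (Maybe.map _) eq)

power-row⁻ : ∀ S k {r a w} → nth (power S k) r ≡ just (a , w) →
             ∃ λ u → nth S r ≡ just (a , u) × w ≡ rowPower (size S) u k
power-row⁻ S k {r} eq with nth S r | trans (sym (nth-map _ S r)) eq
... | just (a , u) | refl = u , refl , refl

entry-power : ∀ {S k r a i x j} → j < k → Entry S r a i x → ∃ λ n → Entry (power S k) r a n (x + j * size S)
entry-power {S} {k} j< (u , eq , p) = _ , _ , power-row S k eq , nth-rowPower (size S) u k j< p

record PowerEntry (S : SkewTab) (k r a n x : ℕ) : Set where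
  field
    {copy index value} : ℕ
    row      : List ℕ
    isRow    : nth S r ≡ just (a , row)
    isValue  : nth row index ≡ just value
    copy<    : copy < k
    position : n ≡ copy * length row + index
    shifted  : x ≡ value + copy * size S

  original : Entry S r a index value
  original = row , isRow , isValue

power-entry : ∀ {S k r a n x} → Entry (power S k) r a n x → PowerEntry S k r a n x
power-entry {S} {k} (w , eq , p) with power-row⁻ S k eq
... | u , eq' , refl with nth-rowPower⁻ (size S) u k p
...   | j , i , y , j< , n≡ , q , x≡ = record
  { row = u ; isRow = eq' ; isValue = q ; copy< = j< ; position = n≡ ; shifted = x≡ }

copy-< : ∀ {m x y j j'} → x ≤ m → 1 ≤ y → j < j' → x + j * m < y + j' * m
copy-< {m} {x} {y} {j} {j'} x≤ 1≤y j< =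
  ≤-trans (s≤s (≤-trans (+-monoˡ-≤ (j * m) x≤) (*-monoˡ-≤ m j<))) (+-monoˡ-≤ (j' * m) 1≤y)

-- Here weakly decreasing row sizes enter: a lower row has shorter copies, so in a given column it
-- has reached at least the same copy as the row above. Otherwise its position would come before the
-- end of copy `j'`, hence before the start of copy `j` above.
copy-order : ∀ {l l' j j' i i'} → i' < l' → l' ≤ l → j * l + i ≤ j' * l' + i' → j ≤ j'
copy-order {l} {l'} {j} {j'} {i} {i'} i'< l'≤ le = ≮⇒≥ λ j'<j → <-irrefl refl (<-≤-trans (begin-strict
  j' * l' + i'     <⟨ +-monoʳ-< (j' * l') i'< ⟩
  j' * l' + l'     ≡⟨ +-comm (j' * l') l' ⟩
  suc j' * l'      ≤⟨ *-mono-≤ j'<j l'≤ ⟩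
  j * l            ≤⟨ m≤m+n (j * l) i ⟩
  j * l + i        ∎) le)
  where open ≤-Reasoning

module _ {S : SkewTab} (G : Good S) (k : ℕ) where

  open Good G
  open PowerEntry

  private
    m : ℕ
    m = size S

    power-shape : SkewShape (power S k)
    power-shape r≤ p q with power-row⁻ S k p | power-row⁻ S k q
    ... | u , p' , refl | v , q' , refl
      rewrite length-rowPower m u k | length-rowPower m v k with shape r≤ p' q' | lengths r≤ p' q'
    ... | b≤a , _ | lens = b≤a , +-mono-≤ b≤a (*-monoʳ-≤ k lens)

    compare : ∀ {r a n x r' a' n' x'} (e : PowerEntry S k r a n x) (e' : PowerEntry S k r' a' n' x') →
              copy e ≤ copy e' → (copy e ≡ copy e' → value e < value e') → x < x'
    compare e e' le lt = subst₂ _<_ (sym (shifted e)) (sym (shifted e')) (ordered (m≤n⇒m<n∨m≡n le))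
      where
      ordered : copy e < copy e' ⊎ copy e ≡ copy e' → value e + copy e * m < value e' + copy e' * m
      ordered (inj₁ j<) = copy-< {m} (bounded (original e)) (positive (original e')) j<
      ordered (inj₂ j≡) = subst (λ j → value e + copy e * m < value e' + j * m) j≡ (+-monoˡ-< (copy e * m) (lt j≡))

    rows : ∀ {r a n n' x y} → Entry (power S k) r a n x → Entry (power S k) r a n' y → n < n' → x < y
    rows e e' lt with power-entry {S} {k} e | power-entry {S} {k} e'
    ... | f@record { row = u ; isRow = eq ; position = refl } | f'@record { isRow = eq' ; position = refl }
      with refl ← trans (sym eq) eq' =
      compare f f' (copy-order {length u} (nth-< u (isValue f')) ≤-refl (<⇒≤ lt)) λ j≡ →
        rowIncr valid (cell-entry (original f)) (cell-entry (original f'))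
          (+-monoʳ-< _ (+-cancelˡ-< (copy f * length u) _ _
            (subst (λ j → copy f * length u + index f < j * length u + index f') (sym j≡) lt)))

    below : ∀ {r r' c c' x y} → cell (toGrid S) r c ≡ entry x → cell (toGrid S) r' c' ≡ entry y → r < r' → c ≤ c' → x < y
    below p q r< c≤ = ≤∧≢⇒< (mono valid p q (<⇒≤ r<) c≤) λ { refl → <⇒≢ r< (proj₁ (distinct valid p q)) }

    cols : ∀ {r r' a b n n' x y} → Entry (power S k) r a n x → Entry (power S k) r' b n' y → r < r' →
           a + n ≡ b + n' → x < y
    cols {a = a} {b} e e' r< c≡ with power-entry {S} {k} e | power-entry {S} {k} e'
    ... | f@record { row = u ; isRow = eq ; position = refl } | f'@record { row = v ; isRow = eq' ; position = refl }
      with shape (<⇒≤ r<) eq eq' | lengths (<⇒≤ r<) eq eq'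
    ...   | b≤a , _ | lens =
      compare f f' (copy-order {length u} (nth-< v (isValue f')) lens
                     (+-cancelˡ-≤ b _ _ (≤-trans (+-monoˡ-≤ _ b≤a) (≤-reflexive c≡)))) λ j≡ →
        below (cell-entry (original f)) (cell-entry (original f')) r< (same-copy j≡)
      where
      open ≤-Reasoning
      -- The preceding copies take up no more room in the lower row, so within `S` the lower entry
      -- lies weakly to the right of the upper one, and `below` applies.
      same-copy : copy f ≡ copy f' → a + index f ≤ b + index f'
      same-copy j≡ = +-cancelˡ-≤ (copy f * length u) _ _ (begin
        copy f * length u + (a + index f)   ≡⟨ swap-+ (copy f * length u) a (index f) ⟩
        a + (copy f * length u + index f)   ≡⟨ c≡ ⟩
        b + (copy f' * length v + index f') ≡⟨ swap-+ (copy f' * length v) b (index f') ⟨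
        copy f' * length v + (b + index f') ≤⟨ +-monoˡ-≤ (b + index f') (*-mono-≤ (≤-reflexive (sym j≡)) lens) ⟩
        copy f * length u + (b + index f')  ∎)
        where
        swap-+ : ∀ x y z → x + (y + z) ≡ y + (x + z)
        swap-+ x y z = trans (sym (+-assoc x y z)) (trans (cong (_+ z) (+-comm x y)) (+-assoc y x z))

    dist : ∀ {r r' a b n n' x} → Entry (power S k) r a n x → Entry (power S k) r' b n' x → r ≡ r' × a + n ≡ b + n'
    dist {a = a} e e' with power-entry {S} {k} e | power-entry {S} {k} e'
    ... | f@record { row = u ; isRow = eq ; position = refl } | f'@record { row = v ; isRow = eq' ; position = refl }
      with <-cmp (copy f) (copy f')
    ... | tri< lt _ _ = ⊥-elim (<-irrefl refl (compare f f' (<⇒≤ lt) λ j≡ → contradiction lt (<-irrefl j≡)))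
    ... | tri> _ _ lt = ⊥-elim (<-irrefl refl (compare f' f (<⇒≤ lt) λ j≡ → contradiction lt (<-irrefl j≡)))
    ... | tri≈ _ j≡ _
      with v≡ ← +-cancelʳ-≡ (copy f * m) (value f) (value f')
                  (trans (sym (shifted f)) (trans (shifted f') (cong (λ j → value f' + j * m) (sym j≡))))
      with entry-unique (original f) (subst (Entry S _ _ _) (sym v≡) (original f'))
    ...   | refl , c≡ with refl ← trans (sym eq) eq' =
      refl , cong (a +_) (cong₂ (λ j i → j * length u + i) j≡ (+-cancelˡ-≡ a _ _ c≡))

  power-valid : Valid (cell (toGrid (power S k))) Nowhere
  power-valid = toGrid-valid {power S k} power-shape rows cols dist

-- Elementary dual equivalence moves

relabel : (ℕ → ℕ) → SkewTab → SkewTab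
relabel f = map (λ p → proj₁ p , map f (proj₂ p))

opaque
  unfolding adj mapGrid

  swapEntries-adj : ∀ u S → swapEntries u (suc u) S ≡ relabel (adj u) S
  swapEntries-adj u S = refl

  mapGrid-toGrid : ∀ f S → mapGrid f (toGrid S) ≡ toGrid (relabel f S)
  mapGrid-toGrid f []            = refl
  mapGrid-toGrid f ((a , u) ∷ S) = cong₂ _∷_ (row a) (mapGrid-toGrid f S)
    where
    row : ∀ a → map (Maybe.map f) (replicate a nothing ++ map just u) ≡ replicate a nothing ++ map just (map f u)
    row zero    = trans (sym (map-∘ u)) (map-∘ u)
    row (suc a) = cong (nothing ∷_) (row a)

size-relabel : ∀ f S → size (relabel f S) ≡ size S
size-relabel f []            = refl
size-relabel f ((a , u) ∷ S) = cong₂ _+_ (length-map f u) (size-relabel f S)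

pos-nth : ∀ w {x n} → pos w x ≡ just n → nth w n ≡ just x
pos-nth (y ∷ w) {x} eq with y ≟ x
pos-nth (y ∷ w) {x} eq    | yes refl rewrite dec-true (x ≟ x) refl with refl ← eq = refl
pos-nth (y ∷ w) {x} eq    | no ne rewrite dec-false (y ≟ x) ne with pos w x in e
pos-nth (y ∷ w) {x} refl  | no ne | just n = pos-nth w e

pos-++ : ∀ u v {x n} → pos (u ++ v) x ≡ just n →
         pos u x ≡ just n ⊎ (∃ λ n' → pos v x ≡ just n' × n ≡ length u + n')
pos-++ []      v eq = inj₂ (_ , eq , refl)
pos-++ (y ∷ u) v {x} eq with y ≡ᵇ x
... | true  = inj₁ eq
... | false with pos (u ++ v) x in e
pos-++ (y ∷ u) v {x} refl | false | just n with pos-++ u v e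
... | inj₁ e' = inj₁ (cong (Maybe.map suc) e')
... | inj₂ (n' , e' , eq') = inj₂ (n' , e' , cong suc eq')

Precedes : SkewTab → ℕ → ℕ → Set
Precedes S x y = ∃₂ λ r r' → ∃₂ λ a i → ∃₂ λ b i' → Entry S r a i x × Entry S r' b i' y × (r' < r ⊎ (r ≡ r' × i < i'))

pos-precedes : ∀ S {x y n n'} → pos (readingWord S) x ≡ just n → pos (readingWord S) y ≡ just n' → n < n' →
               Precedes S x y
pos-precedes [] ()
pos-precedes (p@(a , w) ∷ S) {x} {y} e e' lt rewrite readingWord-∷ p S
  with pos-++ (readingWord S) w e | pos-++ (readingWord S) w e'
... | inj₁ f | inj₁ f' with pos-precedes S f f' lt
...   | r , r' , a , i , b , i' , q , q' , inj₁ r< = suc r , suc r' , a , i , b , i' , q , q' , inj₁ (s≤s r<)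
...   | r , r' , a , i , b , i' , q , q' , inj₂ (refl , i<) = suc r , suc r , a , i , b , i' , q , q' , inj₂ (refl , i<)
pos-precedes (p@(a , w) ∷ S) e e' lt | inj₂ (n , f , refl) | inj₂ (n' , f' , refl) =
  0 , 0 , a , n , a , n' , (w , refl , pos-nth w f) , (w , refl , pos-nth w f') ,
  inj₂ (refl , +-cancelˡ-< (length (readingWord S)) n n' lt)
pos-precedes (p@(a , w) ∷ S) e e' lt | inj₂ (n , f , refl) | inj₁ f' =
  contradiction (<-trans lt (nth-< (readingWord S) (pos-nth (readingWord S) f'))) (≤⇒≯ (m≤m+n _ n))
pos-precedes (p@(a , w) ∷ S) {x} e e' lt | inj₁ f | inj₂ (n' , f' , refl) with in-rest S (pos-nth (readingWord S) f)
  where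
  in-rest : ∀ S {n} → nth (readingWord S) n ≡ just x → ∃₂ λ r a → ∃ λ i → Entry S r a i x
  in-rest (q@(b , v) ∷ S) {n} e rewrite readingWord-∷ q S with n <? length (readingWord S)
  ... | yes lt = let r , a , i , e' = in-rest S (trans (sym (nth-++-< (readingWord S) v lt)) e) in suc r , a , i , e'
  ... | no nlt with n ∸ length (readingWord S) | m+[n∸m]≡n (≮⇒≥ nlt)
  ...   | i | refl = 0 , b , i , v , refl , trans (sym (nth-++-+ (readingWord S) v i)) e
... | r , b , i , q = suc r , 0 , b , i , a , n' , q , (w , refl , pos-nth w f') , inj₁ (s≤s z≤n)

<ᵇ-true : ∀ {m n} → (m <ᵇ n) ≡ true → m < n
<ᵇ-true {m} {n} eq = <ᵇ⇒< m n (subst Bool.T (sym eq) tt)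

between-cases : ∀ p q r → between p q r ≡ true → (q < p × p < r) ⊎ (r < p × p < q)
between-cases p q r eq with q <ᵇ p in e₁ | p <ᵇ r in e₂ | r <ᵇ p in e₃ | p <ᵇ q in e₄ | eq
... | true  | true  | _     | _     | _  = inj₁ (<ᵇ-true e₁ , <ᵇ-true e₂)
... | true  | false | true  | true  | _  = inj₂ (<ᵇ-true e₃ , <ᵇ-true e₄)
... | false | _     | true  | true  | _  = inj₂ (<ᵇ-true e₃ , <ᵇ-true e₄)
... | true  | false | true  | false | ()
... | true  | false | false | _     | ()
... | false | _     | true  | false | ()
... | false | _     | false | _     | ()

module _ {p : ℕ} {g : Grid} {a b c : ℕ}
         (row₀ : InRow (cell g) a p) (row₁ : InRow (cell g) b (suc p)) (row₂ : InRow (cell g) c (suc (suc p))) where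

  -- The alternatives are the reading orders `p + 1`, `p`, `p + 2` and `p + 2`, `p`, `p + 1`,
  -- expressed by rows.
  exchange-upper : (c ≤ a × a < b) ⊎ (b ≤ a × a < c) → Exchange p g (mapGrid (adj (suc p)) g)
  exchange-upper = λ
    { (inj₁ (c≤a , a<b)) → inj₁ ((_ , _ , row₀ , row₁ , a<b) , (_ , _ , row₁ , row₂ , <⇒≤ (≤-<-trans c≤a a<b)) ,
                                 (_ , _ , row₀' , row-upper row₂ , c≤a) , (_ , _ , row-upper row₂ , row-lower row₁ , ≤-<-trans c≤a a<b))
    ; (inj₂ (b≤a , a<c)) → inj₂ ((_ , _ , row₀ , row₁ , b≤a) , (_ , _ , row₁ , row₂ , ≤-<-trans b≤a a<c) ,
                                 (_ , _ , row₀' , row-upper row₂ , a<c) , (_ , _ , row-upper row₂ , row-lower row₁ , <⇒≤ (≤-<-trans b≤a a<c))) }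
    where
    row₀' : InRow (cell (mapGrid (adj (suc p)) g)) a p
    row₀' = row-other (1+n≢n ∘ sym) (<⇒≢ (m<n+m p {2} (s≤s z≤n))) row₀

  -- The alternatives are the reading orders `p`, `p + 2`, `p + 1` and `p + 1`, `p + 2`, `p`.
  exchange-lower : (c ≤ a × b < c) ⊎ (c ≤ b × a < c) → Exchange p g (mapGrid (adj p) g)
  exchange-lower = λ
    { (inj₁ (c≤a , b<c)) → inj₂ ((_ , _ , row₀ , row₁ , <⇒≤ (<-≤-trans b<c c≤a)) , (_ , _ , row₁ , row₂ , b<c) ,
                                 (_ , _ , row-upper row₁ , row-lower row₀ , <-≤-trans b<c c≤a) , (_ , _ , row-lower row₀ , row₂' , c≤a))
    ; (inj₂ (c≤b , a<c)) → inj₁ ((_ , _ , row₀ , row₁ , <-≤-trans a<c c≤b) , (_ , _ , row₁ , row₂ , c≤b) ,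
                                 (_ , _ , row-upper row₁ , row-lower row₀ , <⇒≤ (<-≤-trans a<c c≤b)) , (_ , _ , row-lower row₀ , row₂' , a<c)) }
    where
    row₂' : InRow (cell (mapGrid (adj p) g)) c (suc (suc p))
    row₂' = row-other (λ ()) 1+n≢n row₂

-- The bounds on `p` keep the three entries of each shifted move inside a single copy.
data DMoveView (S : SkewTab) : SkewTab → Set where
  idle      : DMoveView S S
  exchanged : ∀ {p u} → u ≡ p ⊎ u ≡ suc p → 1 ≤ p → suc (suc p) ≤ size S →
              Exchange p (toGrid S) (mapGrid (adj u) (toGrid S)) → DMoveView S (relabel (adj u) S)

module _ {S : SkewTab} (G : Good S) where

  open Good G

  private
    -- Reading order expressed by rows: the earlier entry is weakly lower, and strictly lower if it
    -- is the larger one, because rows increase.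
    Rows : ℕ → ℕ → Set
    Rows x y = ∃₂ λ r r' → InRow (cell (toGrid S)) r x × InRow (cell (toGrid S)) r' y × (x < y → r' ≤ r) × (y < x → r' < r)

    precedes-rows : ∀ {x y} → Precedes S x y → Rows x y
    precedes-rows (r , r' , a , i , b , i' , e , e' , inj₁ lt) =
      r , r' , (_ , cell-entry e) , (_ , cell-entry e') , (λ _ → <⇒≤ lt) , (λ _ → lt)
    precedes-rows (r , r , a , i , b , i' , e@(u , eq , p) , e'@(_ , eq' , p') , inj₂ (refl , lt)) with refl ← trans (sym eq) eq' =
      r , r , (_ , cell-entry e) , (_ , cell-entry e') , (λ _ → ≤-refl) ,
      λ y<x → contradiction y<x (<⇒≯ (rowIncr valid (cell-entry e) (cell-entry e') (+-monoʳ-< a lt)))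

    upper-case : ∀ {p n n₀ n₁} → pos (readingWord S) p ≡ just n → pos (readingWord S) (suc p) ≡ just n₀ →
                 pos (readingWord S) (suc (suc p)) ≡ just n₁ → (n₀ < n × n < n₁) ⊎ (n₁ < n × n < n₀) →
                 DMoveView S (relabel (adj (suc p)) S)
    upper-case {p} e₀ e₁ e₂ (inj₁ (lt , lt'))
      with precedes-rows (pos-precedes S e₁ e₀ lt) | precedes-rows (pos-precedes S e₀ e₂ lt')
    ... | _ , _ , i₁ , i₀ , _ , a<b | _ , _ , i₀' , i₂ , c≤a , _ with refl ← row-unique valid i₀ i₀' =
      exchanged (inj₂ refl) (row-positive i₀) (row-bounded i₂)
        (exchange-upper i₀ i₁ i₂ (inj₁ (c≤a (<-trans (n<1+n p) (n<1+n _)) , a<b (n<1+n p))))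
    upper-case {p} e₀ e₁ e₂ (inj₂ (lt , lt'))
      with precedes-rows (pos-precedes S e₂ e₀ lt) | precedes-rows (pos-precedes S e₀ e₁ lt')
    ... | _ , _ , i₂ , i₀ , _ , a<c | _ , _ , i₀' , i₁ , b≤a , _ with refl ← row-unique valid i₀ i₀' =
      exchanged (inj₂ refl) (row-positive i₀) (row-bounded i₂)
        (exchange-upper i₀ i₁ i₂ (inj₂ (b≤a (n<1+n p) , a<c (<-trans (n<1+n p) (n<1+n _)))))

    lower-case : ∀ {p n n₀ n₁} → pos (readingWord S) p ≡ just n₀ → pos (readingWord S) (suc p) ≡ just n₁ →
                 pos (readingWord S) (suc (suc p)) ≡ just n → (n₀ < n × n < n₁) ⊎ (n₁ < n × n < n₀) →
                 DMoveView S (relabel (adj p) S)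
    lower-case {p} e₀ e₁ e₂ (inj₁ (lt , lt'))
      with precedes-rows (pos-precedes S e₀ e₂ lt) | precedes-rows (pos-precedes S e₂ e₁ lt')
    ... | _ , _ , i₀ , i₂ , c≤a , _ | _ , _ , i₂' , i₁ , _ , b<c with refl ← row-unique valid i₂ i₂' =
      exchanged (inj₁ refl) (row-positive i₀) (row-bounded i₂)
        (exchange-lower i₀ i₁ i₂ (inj₁ (c≤a (<-trans (n<1+n p) (n<1+n _)) , b<c (n<1+n _))))
    lower-case {p} e₀ e₁ e₂ (inj₂ (lt , lt'))
      with precedes-rows (pos-precedes S e₁ e₂ lt) | precedes-rows (pos-precedes S e₂ e₀ lt')
    ... | _ , _ , i₁ , i₂ , c≤b , _ | _ , _ , i₂' , i₀ , _ , a<c with refl ← row-unique valid i₂ i₂' =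
      exchanged (inj₁ refl) (row-positive i₀) (row-bounded i₂)
        (exchange-lower i₀ i₁ i₂ (inj₂ (c≤b (n<1+n _) , a<c (<-trans (n<1+n p) (n<1+n _)))))

  dmove-view : ∀ i → DMoveView S (dmove i S)
  dmove-view zero = idle
  dmove-view (suc p) with pos (readingWord S) p in e₀ | pos (readingWord S) (suc p) in e₁ | pos (readingWord S) (suc (suc p)) in e₂
  ... | nothing | _       | _       = idle
  ... | just _  | nothing | _       = idle
  ... | just _  | just _  | nothing = idle
  ... | just a  | just b  | just c with between a b c in f | between c a b in f'
  ...   | true  | _     = subst (DMoveView S) (sym (swapEntries-adj (suc p) S)) (upper-case e₀ e₁ e₂ (between-cases a b c f))
  ...   | false | true  = subst (DMoveView S) (sym (swapEntries-adj p S)) (lower-case e₀ e₁ e₂ (between-cases c a b f'))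
  ...   | false | false = idle

-- Transporting a move to all copies

relabel-row : ∀ f S {r a w} → nth (relabel f S) r ≡ just (a , w) → ∃ λ u → nth S r ≡ just (a , u) × w ≡ map f u
relabel-row f S {r} eq with nth S r | trans (sym (nth-map _ S r)) eq
... | just (a , u) | refl = u , refl , refl

relabel-entry : ∀ f S {r a i y} → Entry (relabel f S) r a i y → ∃ λ x → Entry S r a i x × y ≡ f x
relabel-entry f S {i = i} (w , eq , p) with relabel-row f S eq
... | u , eq' , refl with nth u i in q | trans (sym (nth-map f u i)) p
...   | just x | refl = x , (u , eq' , q) , refl

adj-preserves : ∀ {P : ℕ → Set} {u x} → P u → P (suc u) → P x → P (adj u x)
adj-preserves {P} {u} {x} pu psu px with adjView u x
... | lower       = subst P (sym (adj-lower u)) psu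
... | upper       = subst P (sym (adj-upper u)) pu
... | other ne ne' = subst P (sym (adj-other ne ne')) px

adj-shift : ∀ u z s → adj (u + s) (z + s) ≡ adj u z + s
adj-shift u z s with adjView u z
... | lower     = trans (adj-lower (u + s)) (cong (_+ s) (sym (adj-lower u)))
... | upper     = trans (adj-upper (u + s)) (cong (_+ s) (sym (adj-upper u)))
... | other p q = trans (adj-other (p ∘ +-cancelʳ-≡ s z u) (q ∘ +-cancelʳ-≡ s z (suc u))) (cong (_+ s) (sym (adj-other p q)))

relabel-good : ∀ {p u S} → Good S → u ≡ p ⊎ u ≡ suc p → 1 ≤ p → suc (suc p) ≤ size S →
               Exchange p (toGrid S) (mapGrid (adj u) (toGrid S)) → Good (relabel (adj u) S)
relabel-good {p} {u} {S} G ch 1≤p ≤m ex = record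
  { shape    = shape'
  ; lengths  = lengths'
  ; valid    = subst (λ g → Valid (cell g) Nowhere) (mapGrid-toGrid (adj u) S) (dual-valid valid (dual u ch refl ex))
  ; positive = λ e → let _ , e' , y≡ = relabel-entry (adj u) S e in
                     subst (1 ≤_) (sym y≡) (adj-preserves {1 ≤_} {u} (1≤u ch) (s≤s z≤n) (positive e'))
  ; bounded  = λ e → let _ , e' , y≡ = relabel-entry (adj u) S e in
                     subst₂ _≤_ (sym y≡) (sym (size-relabel (adj u) S))
                       (adj-preserves {_≤ size S} {u} (<⇒≤ (u<m ch)) (u<m ch) (bounded e'))
  }
  where
  open Good G
  1≤u : u ≡ p ⊎ u ≡ suc p → 1 ≤ u
  1≤u (inj₁ refl) = 1≤p
  1≤u (inj₂ refl) = s≤s z≤n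
  u<m : u ≡ p ⊎ u ≡ suc p → suc u ≤ size S
  u<m (inj₁ refl) = <⇒≤ ≤m
  u<m (inj₂ refl) = ≤m
  shape' : SkewShape (relabel (adj u) S)
  shape' r≤ e e' with relabel-row (adj u) S e | relabel-row (adj u) S e'
  ... | v , f , refl | w , f' , refl rewrite length-map (adj u) v | length-map (adj u) w = shape r≤ f f'
  lengths' : ∀ {r r' a v b w} → r ≤ r' → nth (relabel (adj u) S) r ≡ just (a , v) → nth (relabel (adj u) S) r' ≡ just (b , w) →
             length w ≤ length v
  lengths' r≤ e e' with relabel-row (adj u) S e | relabel-row (adj u) S e'
  ... | v , f , refl | w , f' , refl rewrite length-map (adj u) v | length-map (adj u) w = lengths r≤ f f'

relabel-∘ : ∀ f h S → relabel f (relabel h S) ≡ relabel (f ∘ h) S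
relabel-∘ f h []            = refl
relabel-∘ f h ((a , u) ∷ S) = cong₂ _∷_ (cong (a ,_) (sym (map-∘ u))) (relabel-∘ f h S)

relabel-id : ∀ S → relabel id S ≡ S
relabel-id []            = refl
relabel-id ((a , u) ∷ S) = cong₂ _∷_ (cong (a ,_) (map-id u)) (relabel-id S)

map-proj₁ : ∀ (f : ℕ × List ℕ → List ℕ) S → map proj₁ (map (λ p → proj₁ p , f p) S) ≡ map proj₁ S
map-proj₁ f []      = refl
map-proj₁ f (_ ∷ S) = cong (_ ∷_) (map-proj₁ f S)

all-nth : ∀ {A : Set} {P : A → Set} xs → (∀ {i x} → nth xs i ≡ just x → P x) → All P xs
all-nth []       h = []
all-nth (x ∷ xs) h = h {0} refl ∷ all-nth xs (λ {i} → h {suc i})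

module Copies {p u S} (G : Good S) (ch : u ≡ p ⊎ u ≡ suc p) (1≤p : 1 ≤ p) (p+2≤m : suc (suc p) ≤ size S)
              (ex : Exchange p (toGrid S) (mapGrid (adj u) (toGrid S))) (k : ℕ) where

  open Good G

  private
    m : ℕ
    m = size S

    1≤u : 1 ≤ u
    1≤u = case ch of λ { (inj₁ refl) → 1≤p ; (inj₂ refl) → s≤s z≤n }

    u<m : suc u ≤ m
    u<m = case ch of λ { (inj₁ refl) → <⇒≤ p+2≤m ; (inj₂ refl) → p+2≤m }

    InRange : ℕ → Set
    InRange x = 1 ≤ x × x ≤ m

    adj-inRange : ∀ {x} → InRange x → InRange (adj u x)
    adj-inRange = adj-preserves {InRange} (1≤u , <⇒≤ u<m) (s≤s z≤n , u<m)

    other-copy : ∀ {x n j} → InRange x → n ≢ j → adj (u + n * m) (x + j * m) ≡ x + j * m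
    other-copy {x} {n} {j} (1≤x , x≤m) ne with <-cmp n j
    ... | tri< lt _ _ = adj-other (<⇒≢ (copy-< {m} (<⇒≤ u<m) 1≤x lt) ∘ sym) (<⇒≢ (copy-< {m} u<m 1≤x lt) ∘ sym)
    ... | tri≈ _ e _  = contradiction e ne
    ... | tri> _ _ lt = adj-other (<⇒≢ (copy-< {m} x≤m 1≤u lt)) (<⇒≢ (copy-< {m} x≤m (s≤s z≤n) lt))

    -- The composite of the transpositions in the first `n` copies; these act on disjoint blocks and
    -- do not interfere.
    swapped : ℕ → ℕ → ℕ
    swapped zero    z = z
    swapped (suc n) z = adj (u + n * m) (swapped n z)

    swapped-later : ∀ n {j x} → InRange x → n ≤ j → swapped n (x + j * m) ≡ x + j * m
    swapped-later zero    r le = refl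
    swapped-later (suc n) r le = trans (cong (adj (u + n * m)) (swapped-later n r (<⇒≤ le))) (other-copy {n = n} r (<⇒≢ le))

    swapped-earlier : ∀ n {j x} → InRange x → j < n → swapped n (x + j * m) ≡ adj u x + j * m
    swapped-earlier (suc n) {j} {x} r lt with m≤n⇒m<n∨m≡n (≤-pred lt)
    ... | inj₁ lt' = trans (cong (adj (u + n * m)) (swapped-earlier n r lt')) (other-copy {n = n} (adj-inRange r) (<⇒≢ lt' ∘ sym))
    ... | inj₂ refl = trans (cong (adj (u + n * m)) (swapped-later n r ≤-refl)) (adj-shift u x (n * m))

    swapped-rowPower : ∀ {w} → All InRange w → ∀ {l} → l ≤ k →
                       map (swapped k) (rowPower m w l) ≡ rowPower m (map (adj u) w) l
    swapped-rowPower rs {zero} le = refl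
    swapped-rowPower {w} rs {suc l} le = trans (cong (map (swapped k)) (rowPower-suc m w l))
      (trans (map-++ (swapped k) (rowPower m w l) (shiftRow (l * m) w))
        (trans (cong₂ _++_ (swapped-rowPower rs (<⇒≤ le))
                 (trans (sym (map-∘ w)) (trans (map-cong-local (All.map (λ r → swapped-earlier k r le) rs)) (map-∘ w))))
               (sym (rowPower-suc m (map (adj u) w) l))))

    swapped-rows : ∀ Q → (∀ {r a i x} → Entry Q r a i x → InRange x) →
                   relabel (swapped k) (map (λ q → proj₁ q , rowPower m (proj₂ q) k) Q) ≡
                   map (λ q → proj₁ q , rowPower m (proj₂ q) k) (relabel (adj u) Q)
    swapped-rows []            h = refl
    swapped-rows ((a , w) ∷ Q) h = cong₂ _∷_
      (cong (a ,_) (swapped-rowPower (all-nth w λ q → h {0} (w , refl , q)) ≤-refl))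
      (swapped-rows Q λ { {r} (v , eq , q) → h {suc r} (v , eq , q) })

  -- The first `n` copies already belong to the relabelled tableau, the remaining ones still to `S`.
  stage : ℕ → Grid
  stage zero    = toGrid (power S k)
  stage (suc n) = mapGrid (adj (u + n * m)) (stage n)

  private
    stage-relabel : ∀ n → stage n ≡ toGrid (relabel (swapped n) (power S k))
    stage-relabel zero    = cong toGrid (sym (relabel-id (power S k)))
    stage-relabel (suc n) = trans (cong (mapGrid (adj (u + n * m))) (stage-relabel n))
      (trans (mapGrid-toGrid (adj (u + n * m)) (relabel (swapped n) (power S k)))
             (cong toGrid (relabel-∘ (adj (u + n * m)) (swapped n) (power S k))))

  last-stage : stage k ≡ toGrid (power (relabel (adj u) S) k)
  last-stage = trans (stage-relabel k) (cong toGrid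
    (trans (swapped-rows S λ e → positive e , bounded e)
           (cong (λ l → map (λ q → proj₁ q , rowPower l (proj₂ q) k) (relabel (adj u) S)) (sym (size-relabel (adj u) S)))))

  private
    stage-row : ∀ n {j a x} → n ≤ j → j < k → InRow (cell (toGrid S)) a x → InRow (cell (stage n)) a (x + j * m)
    stage-row zero le j< (_ , q) with cell-toGrid⁻ S q
    ... | _ , _ , e , _ = _ , cell-entry (proj₂ (entry-power {S} j< e))
    stage-row (suc n) {j} {a} le j< i = subst (InRow (cell (stage (suc n))) a)
      (other-copy {n = n} (row-positive i , row-bounded i) (<⇒≢ le)) (row-adj _ (stage-row n (<⇒≤ le) j< i))

    stage-row' : ∀ {n a x} → n < k → InRow (cell (mapGrid (adj u) (toGrid S))) a x → InRow (cell (stage (suc n))) a (x + n * m)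
    stage-row' {n} {a} {x} n< i = subst (InRow (cell (stage (suc n))) a)
      (trans (adj-shift u (adj u x) (n * m)) (cong (_+ n * m) (adj-involutive u x)))
      (row-adj _ (stage-row n ≤-refl n< (row-adj⁻ i)))

  -- Copy `n` has the rows of `S` before this move and those of the relabelled tableau after it, so
  -- the exchange in `S` shifts by `n * m`.
  stage-dual : ∀ {n} → n < k → Dual (p + n * m) (stage n) (stage (suc n))
  stage-dual {n} n< = dual (u + n * m) (choice ch) refl (lift ex)
    where
    choice : u ≡ p ⊎ u ≡ suc p → u + n * m ≡ p + n * m ⊎ u + n * m ≡ suc (p + n * m)
    choice (inj₁ refl) = inj₁ refl
    choice (inj₂ refl) = inj₂ refl
    old : ∀ {a x} → InRow (cell (toGrid S)) a x → InRow (cell (stage n)) a (x + n * m)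
    old = stage-row n ≤-refl n<
    new : ∀ {a x} → InRow (cell (mapGrid (adj u) (toGrid S))) a x → InRow (cell (stage (suc n))) a (x + n * m)
    new = stage-row' n<
    lift : Exchange p (toGrid S) (mapGrid (adj u) (toGrid S)) → Exchange (p + n * m) (stage n) (stage (suc n))
    lift (inj₁ ((_ , _ , p₁ , q₁ , r₁) , (_ , _ , p₂ , q₂ , r₂) , (_ , _ , p₃ , q₃ , r₃) , (_ , _ , p₄ , q₄ , r₄))) =
      inj₁ ((_ , _ , old p₁ , old q₁ , r₁) , (_ , _ , old p₂ , old q₂ , r₂) ,
            (_ , _ , new p₃ , new q₃ , r₃) , (_ , _ , new p₄ , new q₄ , r₄))
    lift (inj₂ ((_ , _ , p₁ , q₁ , r₁) , (_ , _ , p₂ , q₂ , r₂) , (_ , _ , p₃ , q₃ , r₃) , (_ , _ , p₄ , q₄ , r₄))) =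
      inj₂ ((_ , _ , old p₁ , old q₁ , r₁) , (_ , _ , old p₂ , old q₂ , r₂) ,
            (_ , _ , new p₃ , new q₃ , r₃) , (_ , _ , new p₄ , new q₄ , r₄))

  -- Only the initial stage is handled as a power; each later one inherits validity through its
  -- move.
  stage-valid : ∀ {n} → n ≤ k → Valid (cell (stage n)) Nowhere
  stage-valid {zero}  le = power-valid G k
  stage-valid {suc n} le = dual-valid (stage-valid (<⇒≤ le)) (stage-dual le)

-- Stabilization under a move

Block : ℕ → ℕ → ℕ → Set
Block m k x = (k ∸ 1) * m < x × x ≤ k * m

exchange-stabilizes : ∀ {p u S} → Good S → u ≡ p ⊎ u ≡ suc p → 1 ≤ p → suc (suc p) ≤ size S →
  Exchange p (toGrid S) (mapGrid (adj u) (toGrid S)) → ∀ k →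
  (StabilizesAt S (suc k) → StabilizesAt (relabel (adj u) S) (suc k)) ×
  (StabilizesAt (relabel (adj u) S) (suc k) → StabilizesAt S (suc k))
exchange-stabilizes {p} {u} {S} G ch 1≤p p+2≤m ex k =
    (λ st → from-agree (ascend ≤-refl λ x (lo , hi) → st x lo hi))
  , (λ st x lo hi → descend ≤-refl (to-agree st) x (lo , hi))
  where
  open Copies G ch 1≤p p+2≤m ex (suc k)
  m fuel : ℕ
  m = size S
  fuel = sum (map proj₁ (power S (suc k)))
  T : SkewTab
  T = relabel (adj u) S
  Stable : ℕ → Set
  Stable n = Agree (Block m (suc k)) (rectify fuel (stage n)) (stage n)

  -- The fuel is the number of inner cells, which neither relabelling nor taking powers changes.
  Rect-T : Rect (power T (suc k)) ≡ rectify fuel (stage (suc k))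
  Rect-T = cong₂ rectify
    (cong sum (trans (map-proj₁ _ T) (trans (map-proj₁ _ S) (sym (map-proj₁ _ S)))))
    (sym last-stage)
  from-agree : Stable (suc k) → StabilizesAt T (suc k)
  from-agree st x lo hi = trans (cong (λ g → rowOf g x) Rect-T)
    (trans (st x (subst (λ l → Block l (suc k) x) (size-relabel (adj u) S) (lo , hi))) (cong (λ g → rowOf g x) last-stage))
  to-agree : StabilizesAt T (suc k) → Stable (suc k)
  to-agree st x bx = let lo , hi = subst (λ l → Block l (suc k) x) (sym (size-relabel (adj u) S)) bx in
    trans (cong (λ g → rowOf g x) (sym Rect-T)) (trans (st x lo hi) (cong (λ g → rowOf g x) (sym last-stage)))

  transfer : ∀ {n g g' h h'} → n < suc k → Valid (cell g) Nowhere → Valid (cell h) Nowhere →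
             Dual (p + n * m) g g' → Dual (p + n * m) h h' → Agree (Block m (suc k)) g h → Agree (Block m (suc k)) g' h'
  transfer {n} n< V W D E A with m≤n⇒m<n∨m≡n (≤-pred n<)
  -- A move in an earlier copy involves entries up to `p + 2 + n * m`, at most `k * m`, all below
  -- the last block.
  ... | inj₁ lt = agree-outside (λ (lo , _) → ≤-<-trans (≤-trans (+-monoˡ-≤ (n * m) p+2≤m) (*-monoˡ-≤ m lt)) lo) D E A
  -- In the last copy the bounds on `p` place all three entries in the block.
  ... | inj₂ refl = agree-inside V W
    (+-monoˡ-≤ (k * m) 1≤p , +-monoˡ-≤ (k * m) (≤-trans (n≤1+n _) (<⇒≤ p+2≤m)))
    (s≤s (m≤n+m (k * m) p) , +-monoˡ-≤ (k * m) (<⇒≤ p+2≤m))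
    (s≤s (m≤n⇒m≤1+n (m≤n+m (k * m) p)) , +-monoˡ-≤ (k * m) p+2≤m) D E A
  rectified-valid : ∀ {n} → n ≤ suc k → Valid (cell (rectify fuel (stage n))) Nowhere
  rectified-valid le = rectify-valid fuel (stage-valid le)
  rectified-dual : ∀ {n} → n < suc k → Dual (p + n * m) (rectify fuel (stage n)) (rectify fuel (stage (suc n)))
  rectified-dual le = rectify-dual fuel (stage-valid (<⇒≤ le)) (stage-valid le) (stage-dual le)
  ascend : ∀ {n} → n ≤ suc k → Stable 0 → Stable n
  ascend {zero}  le st = st
  ascend {suc n} le st =
    transfer le (rectified-valid (<⇒≤ le)) (stage-valid (<⇒≤ le)) (rectified-dual le) (stage-dual le) (ascend (<⇒≤ le) st)
  descend : ∀ {n} → n ≤ suc k → Stable n → Stable 0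
  descend {zero}  le st = st
  -- The same transfer runs backwards, each move being its own inverse as a relation.
  descend {suc n} le st = descend (<⇒≤ le)
    (transfer le (rectified-valid le) (stage-valid le) (dual-sym (rectified-dual le)) (dual-sym (stage-dual le)) st)

dual-equivalent-stabilizes : ∀ {S T} → Good S → DualEquivalent S T → ∀ k →
  (StabilizesAt S (suc k) → StabilizesAt T (suc k)) × (StabilizesAt T (suc k) → StabilizesAt S (suc k))
dual-equivalent-stabilizes G ε k = id , id
dual-equivalent-stabilizes {S} G ((i , refl) ◅ rest) k = through (dmove-view G i) rest
  where
  through : ∀ {S' T} → DMoveView S S' → Star DMove S' T →
            (StabilizesAt S (suc k) → StabilizesAt T (suc k)) × (StabilizesAt T (suc k) → StabilizesAt S (suc k))
  through idle rest = dual-equivalent-stabilizes G rest k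
  through (exchanged ch 1≤p p+2≤m ex) rest =
    let to , from   = exchange-stabilizes G ch 1≤p p+2≤m ex k
        to' , from' = dual-equivalent-stabilizes (relabel-good G ch 1≤p p+2≤m ex) rest k
    in to' ∘ to , from ∘ from'

stab-transfer : ∀ S T → (∀ k → (StabilizesAt S (suc k) → StabilizesAt T (suc k)) ×
                                 (StabilizesAt T (suc k) → StabilizesAt S (suc k))) →
                ∀ k → IsStab S k → IsStab T k
stab-transfer S T equiv (suc k) (1≤k , st , least) =
  1≤k , proj₁ (equiv k) st , λ { (suc j) 1≤j j<k st' → least (suc j) 1≤j j<k (proj₂ (equiv j) st') }

theorem3p6 : (S T : SkewTab) → IsStandardSkew S → IsStandardSkew T →
    RowSizesDecreasing S → RowSizesDecreasing T → DualEquivalent S T →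
    (k : ℕ) → (IsStab S k → IsStab T k) × (IsStab T k → IsStab S k)
theorem3p6 S T stdS _ decS _ S≈T k = stab-transfer S T equiv k , stab-transfer T S (λ j → swap (equiv j)) k
  where
  equiv : ∀ j → (StabilizesAt S (suc j) → StabilizesAt T (suc j)) × (StabilizesAt T (suc j) → StabilizesAt S (suc j))
  equiv = dual-equivalent-stabilizes (standard-good stdS decS) S≈T
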